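{- Let $m\ge1$ and for $j,k\in\mathbb{N}$ let $c(j,k)$ be the coefficient of $q^jt^k$ in $C^{(m)}_4(q,t)$. For real $a$ put $\lfloor a\rfloor^+=\max(\lfloor a\rfloor,0)$. (a) If $j+k>4m$, then $c(j,k)=\min\left(\lfloor\frac{ -6m+2+3j+k}{2}\rfloor^+,\ \lfloor\frac{6m+2-j-k}{2}\rfloor^+,\ \lfloor\frac{ -6m+2+j+3k}{2}\rfloor^+\right)$. (b) If $j+k=4m$, then $c(j,k)=\min\left(\lfloor\frac{ -m+2+j}{2}\rfloor^+,\ \lfloor\frac{ -m+2+k}{2}\rfloor^+\right)$. (c) If $j+k<4m$, then $c(j,k)=0$. Consequently, for every positive integer $d$ the sequence $(c(d,0),c(d-1,1),\dots,c(1,d-1),c(0,d))$ is unimodal.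
   Context: An $m$-Dyck word of length $4$ is a sequence $\gamma=(\gamma_0,\gamma_1,\gamma_2,\gamma_3)$ of nonnegative integers with $\gamma_0=0$ and $\gamma_i\le\gamma_{i-1}+m$ for $i=1,2,3$; $W^{(m)}_4$ is the set of these. $\mathrm{area}(\gamma)=\sum_i\gamma_i$, $\mathrm{dinv}_m(\gamma)=\sum_{0\le i<j\le3}\mathrm{sc}_m(\gamma_i-\gamma_j)$ where $\mathrm{sc}_m(p)=m+1-p$ if $1\le p\le m$, $\mathrm{sc}_m(p)=m+p$ if $-m\le p\le 0$, and $0$ otherwise. $C^{(m)}_4(q,t)=\sum_{\gamma\in W^{(m)}_4}q^{\mathrm{area}(\gamma)}t^{\mathrm{dinv}_m(\gamma)}$. -}

module Defs where

open import Data.Nat as ℕ using (ℕ; zero; suc; _≤_; _<_)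
open import Data.Integer as ℤ using (ℤ; +_; _-_; _/ℕ_; _⊔_)
open import Data.List using (List; []; _∷_; concatMap; map; filter; length; upTo)
open import Data.Product using (_×_; _,_; ∃-syntax)
open import Relation.Nullary.Decidable using (_×-dec_; yes; no)

-- An m-Dyck word of length 4: (γ₀,γ₁,γ₂,γ₃) with γ₀ = 0 and γᵢ ≤ γᵢ₋₁ + m.
record Word4 : Set where
  constructor word
  field
    γ₀ γ₁ γ₂ γ₃ : ℕ

W4 : ℕ → List Word4
W4 m =
  concatMap (λ g1 →
    concatMap (λ g2 →
      map (λ g3 → word 0 g1 g2 g3) (upTo (suc (g2 ℕ.+ m))))
      (upTo (suc (g1 ℕ.+ m))))
    (upTo (suc m))

area : Word4 → ℕ
area (word g0 g1 g2 g3) = g0 ℕ.+ g1 ℕ.+ g2 ℕ.+ g3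

-- sc_m(p) = m + 1 - p if 1 ≤ p ≤ m;  m + p if -m ≤ p ≤ 0;  0 otherwise.
sc : ℕ → ℤ → ℕ
sc m (+ zero) = m
sc m (+ suc p) with suc p ℕ.≤? m
... | yes _ = m ℕ.∸ p
... | no  _ = 0
sc m ℤ.-[1+ p ] with suc p ℕ.≤? m
... | yes _ = m ℕ.∸ suc p
... | no  _ = 0

dinv : ℕ → Word4 → ℕ
dinv m (word g0 g1 g2 g3) =
  s g0 g1 ℕ.+ s g0 g2 ℕ.+ s g0 g3 ℕ.+ s g1 g2 ℕ.+ s g1 g3 ℕ.+ s g2 g3
  where
    s : ℕ → ℕ → ℕ
    s a b = sc m (+ a - + b)

-- c(j,k) = coefficient of q^j t^k in C^(m)_4(q,t)
--        = number of γ ∈ W^(m)_4 with area γ = j and dinv_m γ = k.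
coeff : ℕ → ℕ → ℕ → ℕ
coeff m j k = length (filter (λ γ → (area γ ℕ.≟ j) ×-dec (dinv m γ ℕ.≟ k)) (W4 m))

-- ⌊ a / 2 ⌋⁺ = max(⌊ a / 2 ⌋, 0) for an integer a  (_/ℕ_ is floor division for positive divisor)
floorHalf⁺ : ℤ → ℤ
floorHalf⁺ a = (a /ℕ 2) ⊔ + 0

Unimodal : ℕ → (ℕ → ℕ) → Set
Unimodal d s = ∃[ p ] (p ≤ d × (∀ i → i < p → s i ≤ s (suc i))
                              × (∀ i → p ≤ i → i < d → s (suc i) ≤ s i))

module Submission where

-- Let d = j + k > 4m and e = 6m - d. The words are cut into fifteen polyhedral regions on which dinv is affine.
-- There is a numbering of the words, affine on each region, that maps the fibre of words with area j and dinv k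
-- bijectively onto the integer interval [max(e - j, 0), min(⌊e/2⌋, k - ⌈e/2⌉)].
-- That the numbering is well defined, injective and onto is a finite set of statements of linear integer
-- arithmetic in m, j, k and the letters, which are decided by Fourier–Motzkin elimination with integer
-- tightening. For d = 4m the fibre is an explicit segment. Unimodality holds because each formula is a
-- monotone function of min(g(j), g(k)), g monotone.

open import Defs
open import Data.Bool using (Bool; true; false; _∧_; _∨_; if_then_else_; T)
open import Data.Bool.ListAction using (all)
open import Data.Bool.Properties using (T-≡)
open import Data.Empty using (⊥; ⊥-elim)
open import Data.Fin using (Fin; zero; suc; toℕ; fromℕ<)
open import Data.Fin.Properties using (toℕ-fromℕ<)
open import Data.Integer as ℤ using (ℤ; +_; -[1+_]; 0ℤ; 1ℤ; _⊔_; _⊓_; ∣_∣; _/ℕ_; _%ℕ_; +≤+)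
import Data.Integer.DivMod as ℤ
import Data.Integer.Properties as ℤ
open import Data.Integer.Tactic.RingSolver using (solve-∀)
open import Data.List using (List; []; _∷_; _++_; map; filter; foldr; replicate; concatMap; length; upTo)
open import Data.List.Membership.Propositional using (_∈_; lose; find)
open import Data.List.Membership.Propositional.Properties
  using (∈-map⁺; ∈-map⁻; ∈-concatMap⁺; ∈-concatMap⁻; ∈-upTo⁺; ∈-upTo⁻; ∈-filter⁺; ∈-filter⁻; ∈-∃++; ∈-++⁺ˡ; ∈-++⁺ʳ; ∈-++⁻)
open import Data.List.Properties using (length-upTo; length-++-sucʳ)
open import Data.List.Relation.Unary.All as All using (All; []; _∷_)
import Data.List.Relation.Unary.All.Properties as All
open import Data.List.Relation.Unary.AllPairs using ([]; _∷_)
open import Data.List.Relation.Unary.Any using (here; there)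
open import Data.List.Relation.Unary.Unique.Propositional using (Unique)
import Data.List.Relation.Unary.Unique.Propositional.Properties as Unique
open import Data.Maybe using (Maybe; just; nothing)
open import Data.Nat as ℕ using (ℕ; zero; suc; z≤n; s≤s; NonZero)
import Data.Nat.DivMod as ℕ
import Data.Nat.Properties as ℕ
open import Data.Product using (_×_; _,_; proj₁; proj₂; ∃-syntax)
open import Data.Sum using (_⊎_; inj₁; inj₂)
open import Data.Unit using (tt)
open import Function using (_∘_; id; Equivalence)
open import Relation.Binary.Definitions using (tri<; tri≈; tri>)
open import Relation.Binary.PropositionalEquality using (_≡_; refl; sym; trans; cong; cong₂; subst; subst₂)
open import Relation.Nullary using (Dec; yes; no)
open import Relation.Nullary.Decidable using (_×-dec_)

-- `sc` has slopes 0 and ±1, and its thresholds are constants or ±m, so area, dinv and the cuts are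
-- linear with numerical coefficients even when m, j, k are variables: one check serves every m.
-- Surjectivity asks for words, that is, for an existential quantifier. It is avoided by writing
-- each letter affinely in the parameters, the index and at most one quotient, which is computed
-- outside the formula.
--
-- The three floors of (a) are j + 1 - ⌈e/2⌉, ⌊e/2⌋ + 1 and k + 1 - ⌈e/2⌉. Three of the four
-- differences between an upper and a lower bound of the interval produce them. The fourth, (k -
-- ⌈e/2⌉) - (e - j), is at least ⌊e/2⌋ because 2e < 4m < d.
--
-- The decision procedure is proved sound only: that it succeeds on each formula is checked by
-- evaluating it.

-- Rows are affine forms, with the constant term first.
module LinearArithmetic where

  -- Affine rows and integer tightening

  open import Data.Integer using (_+_; _-_; -_; _*_; _≤_; _<_)

  Row : Set
  Row = List ℤ

  infix 8 _∙_

  _∙_ : Row → List ℤ → ℤ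
  [] ∙ _ = 0ℤ
  (_ ∷ _) ∙ [] = 0ℤ
  (c ∷ cs) ∙ (x ∷ xs) = c * x + cs ∙ xs

  scale : ℤ → Row → Row
  scale k = map (k *_)

  combine : ℤ → Row → ℤ → Row → Row
  combine x [] y q = scale y q
  combine x (c ∷ p) y [] = scale x (c ∷ p)
  combine x (c ∷ p) y (d ∷ q) = x * c + y * d ∷ combine x p y q

  scale-∙ : ∀ k p ρ → scale k p ∙ ρ ≡ k * (p ∙ ρ)
  scale-∙ k [] ρ = sym (ℤ.*-zeroʳ k)
  scale-∙ k (c ∷ p) [] = sym (ℤ.*-zeroʳ k)
  scale-∙ k (c ∷ p) (x ∷ ρ) rewrite scale-∙ k p ρ = lemma k c x (p ∙ ρ)
    where
      lemma : ∀ k c x s → k * c * x + k * s ≡ k * (c * x + s)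
      lemma = solve-∀

  combine-∙ : ∀ x p y q ρ → combine x p y q ∙ ρ ≡ x * (p ∙ ρ) + y * (q ∙ ρ)
  combine-∙ x [] y q ρ rewrite scale-∙ y q ρ | ℤ.*-zeroʳ x = sym (ℤ.+-identityˡ _)
  combine-∙ x (c ∷ p) y [] ρ rewrite scale-∙ x (c ∷ p) ρ | ℤ.*-zeroʳ y = sym (ℤ.+-identityʳ _)
  combine-∙ x (c ∷ p) y (d ∷ q) [] rewrite ℤ.*-zeroʳ x | ℤ.*-zeroʳ y = refl
  combine-∙ x (c ∷ p) y (d ∷ q) (z ∷ ρ) rewrite combine-∙ x p y q ρ = lemma x c y d z (p ∙ ρ) (q ∙ ρ)
    where
      lemma : ∀ x c y d z s t → (x * c + y * d) * z + (x * s + y * t) ≡ x * (c * z + s) + y * (d * z + t)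
      lemma = solve-∀

  infix 4 _⊨_≥0 _⊨_=0

  _⊨_≥0 _⊨_=0 : List ℤ → Row → Set
  ρ ⊨ p ≥0 = 0ℤ ≤ p ∙ (1ℤ ∷ ρ)
  ρ ⊨ p =0 = 0ℤ ≡ p ∙ (1ℤ ∷ ρ)

  coef : ℕ → Row → ℤ
  coef _ [] = 0ℤ
  coef zero (c ∷ _) = c
  coef (suc v) (_ ∷ p) = coef v p

  -- Tightening: g S + c ≥ 0 implies S + ⌊c / g⌋ ≥ 0 over the integers.

  -- Fuel replaces a termination argument. A wrong value is harmless, since `tightenBy` multiplies
  -- back to check that the division is exact.
  gcd′ : ℕ → ℕ → ℕ → ℕ
  gcd′ zero a b = a
  gcd′ (suc f) a zero = a
  gcd′ (suc f) a b@(suc _) = gcd′ f b (a ℕ.% b)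

  content : Row → ℕ
  content = foldr (λ c g → gcd′ 100 ∣ c ∣ g) 0

  divRow : (g : ℕ) .{{_ : ℕ.NonZero g}} → Row → Row
  divRow g = map (_/ℕ g)

  sameℤ : ℤ → ℤ → Bool
  sameℤ (+ m) (+ n) = m ℕ.≡ᵇ n
  sameℤ -[1+ m ] -[1+ n ] = m ℕ.≡ᵇ n
  sameℤ _ _ = false

  sameℤ⇒≡ : ∀ i j → sameℤ i j ≡ true → i ≡ j
  sameℤ⇒≡ (+ m) (+ n) eq = cong +_ (ℕ.≡ᵇ⇒≡ m n (subst T (sym eq) tt))
  sameℤ⇒≡ -[1+ m ] -[1+ n ] eq = cong -[1+_] (ℕ.≡ᵇ⇒≡ m n (subst T (sym eq) tt))

  _≡ᵇ_ : Row → Row → Bool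
  [] ≡ᵇ [] = true
  (c ∷ p) ≡ᵇ (d ∷ q) = if sameℤ c d then p ≡ᵇ q else false
  _ ≡ᵇ _ = false

  ≡ᵇ⇒≡ : ∀ p q → (p ≡ᵇ q) ≡ true → p ≡ q
  ≡ᵇ⇒≡ [] [] _ = refl
  ≡ᵇ⇒≡ (c ∷ p) (d ∷ q) eq with sameℤ c d in e
  ... | true = cong₂ _∷_ (sameℤ⇒≡ c d e) (≡ᵇ⇒≡ p q eq)

  tightenBy : ℕ → ℤ → Row → Row
  tightenBy g@(suc (suc _)) c p =
    if scale (+ g) (divRow g p) ≡ᵇ p then (c /ℕ g) ∷ divRow g p else c ∷ p
  tightenBy _ c p = c ∷ p

  -- Write c = r + qg with r < g. If q + s ≤ -1, then c + gs < g + g(q + s) ≤ 0.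
  floor-≥0 : ∀ g .{{_ : ℕ.NonZero g}} c s → 0ℤ ≤ c + + g * s → 0ℤ ≤ c /ℕ g + s
  floor-≥0 g c s h with 0ℤ ℤ.≤? c /ℕ g + s
  ... | yes p = p
  ... | no ¬p = ⊥-elim (ℤ.<-irrefl refl (ℤ.≤-<-trans h (begin-strict
      c + + g * s                                ≡⟨ cong (_+ + g * s) (ℤ.a≡a%ℕn+[a/ℕn]*n c g) ⟩
      + (c %ℕ g) + (c /ℕ g) * + g + + g * s      ≡⟨ lemma (+ (c %ℕ g)) (c /ℕ g) (+ g) s ⟩
      + (c %ℕ g) + + g * (c /ℕ g + s)            <⟨ ℤ.+-monoˡ-< (+ g * (c /ℕ g + s)) (ℤ.+<+ (ℤ.n%ℕd<d c g)) ⟩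
      + g + + g * (c /ℕ g + s)                   ≡⟨ lemma′ (+ g) (c /ℕ g + s) ⟩
      + g * (1ℤ + (c /ℕ g + s))                  ≤⟨ ℤ.*-monoˡ-≤-nonNeg (+ g) (ℤ.i<j⇒suc[i]≤j (ℤ.≰⇒> ¬p)) ⟩
      + g * 0ℤ                                   ≡⟨ ℤ.*-zeroʳ (+ g) ⟩
      0ℤ ∎)))
    where
      open ℤ.≤-Reasoning
      lemma : ∀ r q g s → r + q * g + g * s ≡ r + g * (q + s)
      lemma = solve-∀
      lemma′ : ∀ g t → g + g * t ≡ g * (1ℤ + t)
      lemma′ = solve-∀

  tightenBy-sound : ∀ g c p ρ → ρ ⊨ c ∷ p ≥0 → ρ ⊨ tightenBy g c p ≥0
  tightenBy-sound zero c p ρ h = h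
  tightenBy-sound (suc zero) c p ρ h = h
  tightenBy-sound g@(suc (suc _)) c p ρ h with scale (+ g) (divRow g p) ≡ᵇ p in eq
  ... | false = h
  ... | true = subst (λ z → 0ℤ ≤ z + divRow g p ∙ ρ) (sym (ℤ.*-identityʳ (c /ℕ g)))
        (floor-≥0 g c (divRow g p ∙ ρ)
          (subst (0ℤ ≤_) (cong₂ _+_ (ℤ.*-identityʳ c) p∙ρ) h))
    where
      p∙ρ : p ∙ ρ ≡ + g * (divRow g p ∙ ρ)
      p∙ρ = trans (cong (_∙ ρ) (sym (≡ᵇ⇒≡ (scale (+ g) (divRow g p)) p eq))) (scale-∙ (+ g) (divRow g p) ρ)

  -- Rows with the same non-constant part are merged; nothing signals a row that is a negative constant.

  insert : ℤ → Row → List Row → List Row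
  insert c p [] = (c ∷ p) ∷ []
  insert c p ([] ∷ l) = insert c p l
  -- Of two rows with the same linear part, the one with the smaller constant implies the other.
  insert c p ((d ∷ q) ∷ l) = if p ≡ᵇ q then (c ⊓ d ∷ q) ∷ l else (d ∷ q) ∷ insert c p l

  insert-sound : ∀ {ρ} c p l → ρ ⊨ c ∷ p ≥0 → All (ρ ⊨_≥0) l → All (ρ ⊨_≥0) (insert c p l)
  insert-sound c p [] h [] = h ∷ []
  insert-sound c p ([] ∷ l) h (_ ∷ hs) = insert-sound c p l h hs
  insert-sound {ρ} c p ((d ∷ q) ∷ l) h (h′ ∷ hs) with p ≡ᵇ q in eq
  ... | false = h′ ∷ insert-sound c p l h hs
  ... | true rewrite ≡ᵇ⇒≡ p q eq with ℤ.⊓-sel c d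
  ...   | inj₁ e rewrite e = h ∷ hs
  ...   | inj₂ e rewrite e = h′ ∷ hs

  isZero : Row → Bool
  isZero [] = true
  isZero (+ zero ∷ p) = isZero p
  isZero (_ ∷ _) = false

  isZero-sound : ∀ p ρ → isZero p ≡ true → p ∙ ρ ≡ 0ℤ
  isZero-sound [] ρ _ = refl
  isZero-sound (+ zero ∷ p) [] _ = refl
  isZero-sound (+ zero ∷ p) (x ∷ ρ) eq rewrite isZero-sound p ρ eq = refl

  isNeg : ℤ → Bool
  isNeg (+ _) = false
  isNeg -[1+ _ ] = true

  insertTight : Row → List Row → List Row
  insertTight [] l = l
  insertTight (c ∷ p) l = insert c p l

  add : Row → Maybe (List Row) → Maybe (List Row)
  add _ nothing = nothing
  add [] m = m
  add (c ∷ p) (just l) with isZero p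
  ... | true = if isNeg c then nothing else just l
  ... | false = just (insertTight (tightenBy (content p) c p) l)

  Consistent : List ℤ → Maybe (List Row) → Set
  Consistent ρ nothing = ⊥
  Consistent ρ (just l) = All (ρ ⊨_≥0) l

  add-sound : ∀ {ρ} p m → ρ ⊨ p ≥0 → Consistent ρ m → Consistent ρ (add p m)
  add-sound [] (just l) _ hs = hs
  add-sound {ρ} (c ∷ p) (just l) h hs with isZero p in eq
  ... | true = helper c h
    where
      helper : ∀ c → ρ ⊨ c ∷ p ≥0 → Consistent ρ (if isNeg c then nothing else just l)
      helper (+ _) _ = hs
      helper -[1+ n ] h rewrite isZero-sound p ρ eq with h
      ... | ()
  ... | false with tightenBy (content p) c p | tightenBy-sound (content p) c p ρ h
  ...   | [] | _ = hs
  ...   | d ∷ q | h′ = insert-sound d q l h′ hs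

  addAll : List Row → Maybe (List Row) → Maybe (List Row)
  addAll [] m = m
  addAll (p ∷ ps) m = addAll ps (add p m)

  addAll-sound : ∀ {ρ} ps m → All (ρ ⊨_≥0) ps → Consistent ρ m → Consistent ρ (addAll ps m)
  addAll-sound [] m [] hs = hs
  addAll-sound (p ∷ ps) m (h ∷ hps) hs = addAll-sound ps (add p m) hps (add-sound p m h hs)

  -- Fourier-Motzkin elimination

  resolvent : ℕ → Row → Row → Row
  -- The rows have opposite signs at `v`, so these nonnegative multipliers cancel it.
  resolvent v p q = combine (+ ∣ coef v q ∣) p (+ ∣ coef v p ∣) q

  resolvents : ℕ → Row → List Row → Maybe (List Row) → Maybe (List Row)
  resolvents v p [] m = m
  resolvents v p (q ∷ qs) m = resolvents v p qs (add (resolvent v p q) m)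

  allResolvents : ℕ → List Row → List Row → Maybe (List Row) → Maybe (List Row)
  allResolvents v [] qs m = m
  allResolvents v (p ∷ ps) qs nothing = nothing
  allResolvents v (p ∷ ps) qs m@(just _) = allResolvents v ps qs (resolvents v p qs m)

  record Split : Set where
    constructor split
    field pos neg zer : List Row

  partition : ℕ → List Row → Split → Split
  partition v [] s = s
  partition v (p ∷ ps) (split a b c) with coef v p
  ... | + zero = partition v ps (split a b (p ∷ c))
  ... | + suc _ = partition v ps (split (p ∷ a) b c)
  ... | -[1+ _ ] = partition v ps (split a (p ∷ b) c)

  eliminate : ℕ → List Row → Maybe (List Row)
  eliminate v ps with partition v ps (split [] [] [])
  ... | split a b c = allResolvents v a b (just c)

  combine-≥0 : ∀ {ρ} m p n q → ρ ⊨ p ≥0 → ρ ⊨ q ≥0 → ρ ⊨ combine (+ m) p (+ n) q ≥0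
  combine-≥0 {ρ} m p n q hp hq = subst (0ℤ ≤_) (sym (combine-∙ (+ m) p (+ n) q (1ℤ ∷ ρ)))
    (ℤ.+-mono-≤ (nonneg m hp) (nonneg n hq))
    where
      nonneg : ∀ k {s} → 0ℤ ≤ s → 0ℤ ≤ + k * s
      nonneg k {s} h = subst (_≤ + k * s) (ℤ.*-zeroʳ (+ k)) (ℤ.*-monoˡ-≤-nonNeg (+ k) h)

  resolvents-sound : ∀ {ρ} v p qs m → ρ ⊨ p ≥0 → All (ρ ⊨_≥0) qs → Consistent ρ m → Consistent ρ (resolvents v p qs m)
  resolvents-sound v p [] m h [] hm = hm
  resolvents-sound v p (q ∷ qs) m h (h′ ∷ hs) hm =
    resolvents-sound v p qs _ h hs (add-sound (resolvent v p q) m (combine-≥0 _ p _ q h h′) hm)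

  allResolvents-sound : ∀ {ρ} v ps qs m → All (ρ ⊨_≥0) ps → All (ρ ⊨_≥0) qs → Consistent ρ m → Consistent ρ (allResolvents v ps qs m)
  allResolvents-sound v [] qs m [] hqs hm = hm
  allResolvents-sound v (p ∷ ps) qs m@(just _) (h ∷ hs) hqs hm =
    allResolvents-sound v ps qs _ hs hqs (resolvents-sound v p qs m h hqs hm)

  open Split

  AllSplit : List ℤ → Split → Set
  AllSplit ρ s = All (ρ ⊨_≥0) (pos s) × All (ρ ⊨_≥0) (neg s) × All (ρ ⊨_≥0) (zer s)

  partition-sound : ∀ {ρ} v ps s → All (ρ ⊨_≥0) ps → AllSplit ρ s → AllSplit ρ (partition v ps s)
  partition-sound v [] s [] hs = hs
  partition-sound v (p ∷ ps) (split a b c) (h ∷ hps) (ha , hb , hc) with coef v p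
  ... | + zero = partition-sound v ps _ hps (ha , hb , h ∷ hc)
  ... | + suc _ = partition-sound v ps _ hps (h ∷ ha , hb , hc)
  ... | -[1+ _ ] = partition-sound v ps _ hps (ha , h ∷ hb , hc)

  eliminate-sound : ∀ {ρ} v ps → All (ρ ⊨_≥0) ps → Consistent ρ (eliminate v ps)
  eliminate-sound v ps h with partition v ps (split [] [] []) | partition-sound v ps (split [] [] []) h ([] , [] , [])
  ... | split a b c | ha , hb , hc = allResolvents-sound v a b (just c) ha hb hc

  -- The variable whose elimination creates the fewest rows is eliminated first; the offset 100 in the cost
  -- keeps the subtraction from truncating.

  tally : List Row → List (ℕ × ℕ)
  tally = foldr (λ p → count (drop1 p)) []
    where
      drop1 : Row → Row
      drop1 [] = []
      drop1 (_ ∷ p) = p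
      bump : ℤ → ℕ × ℕ → ℕ × ℕ
      bump (+ zero) t = t
      bump (+ suc _) (a , b) = suc a , b
      bump -[1+ _ ] (a , b) = a , suc b
      count : Row → List (ℕ × ℕ) → List (ℕ × ℕ)
      count [] t = t
      count (c ∷ p) [] = bump c (0 , 0) ∷ count p []
      count (c ∷ p) (x ∷ t) = bump c x ∷ count p t

  cost : ℕ × ℕ → Maybe ℕ
  cost (zero , zero) = nothing
  cost (a , b) = just (100 ℕ.+ a ℕ.* b ℕ.∸ (a ℕ.+ b))

  cheapest : ℕ → ℕ → Maybe ℕ → List (ℕ × ℕ) → ℕ
  cheapest v best _ [] = best
  cheapest v best bc (t ∷ ts) with cost t | bc
  ... | nothing | _ = cheapest (suc v) best bc ts
  ... | just c | nothing = cheapest (suc v) v (just c) ts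
  ... | just c | just d = if c ℕ.<ᵇ d then cheapest (suc v) v (just c) ts else cheapest (suc v) best (just d) ts

  -- `true` certifies a contradiction. Running out of fuel or of rows yields `false`, so the choice
  -- of variable affects only success, never soundness.
  fm : ℕ → Maybe (List Row) → Bool
  fm zero _ = false
  fm (suc f) nothing = true
  fm (suc f) (just []) = false
  fm (suc f) (just ps@(_ ∷ _)) = fm f (eliminate (cheapest 1 0 nothing (tally ps)) ps)

  fm-sound : ∀ {ρ} f m → fm f m ≡ true → Consistent ρ m → ⊥
  fm-sound (suc f) nothing _ h = h
  fm-sound (suc f) (just ps@(_ ∷ _)) eq h = fm-sound f _ eq (eliminate-sound _ ps h)

  -- Solving equations that have a unit coefficient

  unitAt : ℕ → Row → Maybe ℕ
  unitAt v [] = nothing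
  unitAt v (c ∷ p) = if ∣ c ∣ ℕ.≡ᵇ 1 then just v else unitAt (suc v) p

  unitVar : Row → Maybe ℕ
  unitVar [] = nothing
  unitVar (_ ∷ p) = unitAt 1 p

  -- When the coefficient u of `v` in `e` is ±1, c - (u * c) * u = 0, so `v` disappears without `p`
  -- being rescaled.
  substitute : ℕ → Row → Row → Row
  substitute v e p with coef v p
  ... | + zero = p
  ... | c = combine 1ℤ p (- (coef v e * c)) e

  solveEqs : ℕ → List Row → List Row → List Row → List Row
  solveEqs zero es ds ps = ps
  solveEqs (suc f) [] ds ps = foldr (λ e → λ l → e ∷ scale (- 1ℤ) e ∷ l) ps ds
  solveEqs (suc f) (e ∷ es) ds ps with unitVar e
  ... | nothing = solveEqs f es (e ∷ ds) ps
  -- The postponed equations rejoin the queue, since the substitution may have given them a unit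
  -- coefficient.
  ... | just v = solveEqs f (map (substitute v e) (ds ++ es)) [] (map (substitute v e) ps)

  private
    +-zero-mult : ∀ a k → 1ℤ * a + k * 0ℤ ≡ a
    +-zero-mult = solve-∀

  combine-eq : ∀ {ρ} k p e → ρ ⊨ e =0 → combine 1ℤ p k e ∙ (1ℤ ∷ ρ) ≡ p ∙ (1ℤ ∷ ρ)
  combine-eq {ρ} k p e h rewrite combine-∙ 1ℤ p k e (1ℤ ∷ ρ) | sym h = +-zero-mult (p ∙ (1ℤ ∷ ρ)) k

  substitute-∙ : ∀ {ρ} v e p → ρ ⊨ e =0 → substitute v e p ∙ (1ℤ ∷ ρ) ≡ p ∙ (1ℤ ∷ ρ)
  substitute-∙ {ρ} v e p h with coef v p
  ... | + zero = refl
  ... | + suc _ = combine-eq {ρ} _ p e h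
  ... | -[1+ _ ] = combine-eq {ρ} _ p e h

  eq⇒ineqs : ∀ {ρ} ds ps → All (ρ ⊨_=0) ds → All (ρ ⊨_≥0) ps → All (ρ ⊨_≥0) (foldr (λ e → λ l → e ∷ scale (- 1ℤ) e ∷ l) ps ds)
  eq⇒ineqs [] ps [] hps = hps
  eq⇒ineqs {ρ} (d ∷ ds) ps (h ∷ hs) hps =
    ℤ.≤-reflexive h ∷ ℤ.≤-reflexive (trans (cong (- 1ℤ *_) h) (sym (scale-∙ (- 1ℤ) d (1ℤ ∷ ρ)))) ∷ eq⇒ineqs ds ps hs hps

  solveEqs-sound : ∀ {ρ} f es ds ps → All (ρ ⊨_=0) es → All (ρ ⊨_=0) ds → All (ρ ⊨_≥0) ps → All (ρ ⊨_≥0) (solveEqs f es ds ps)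
  solveEqs-sound zero es ds ps hes hds hps = hps
  solveEqs-sound (suc f) [] ds ps [] hds hps = eq⇒ineqs ds ps hds hps
  solveEqs-sound {ρ} (suc f) (e ∷ es) ds ps (h ∷ hes) hds hps with unitVar e
  ... | nothing = solveEqs-sound f es (e ∷ ds) ps hes (h ∷ hds) hps
  ... | just v = solveEqs-sound f _ [] _
        (All.map⁺ (All.map (λ {p} h′ → trans h′ (sym (substitute-∙ {ρ} v e p h))) (All.++⁺ hds hes)))
        []
        (All.map⁺ (All.map (λ {p} h′ → subst (0ℤ ≤_) (sym (substitute-∙ {ρ} v e p h)) h′) hps))

  infeasible : List Row → List Row → Bool
  infeasible es ps = fm 100 (addAll (solveEqs 100 es [] ps) (just []))

  infeasible-sound : ∀ {ρ} es ps → infeasible es ps ≡ true → All (ρ ⊨_=0) es → All (ρ ⊨_≥0) ps → ⊥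
  infeasible-sound es ps eq hes hps = fm-sound 100 _ eq (addAll-sound _ (just []) (solveEqs-sound 100 es [] ps hes [] hps) [])

  -- Formulas and their negation normal forms

  infixl 7 _⊕_ _⊖_
  infixl 8 _⊛_
  infix 6 _≼_ _≺_ _≗_
  infixr 5 _and_
  infixr 4 _or_
  infixr 3 _implies_

  data Expr : Set where
    var : ℕ → Expr
    lit : ℤ → Expr
    _⊕_ _⊖_ : Expr → Expr → Expr
    ⊝_ : Expr → Expr
    _⊛_ : ℕ → Expr → Expr

  data Formula : Set where
    _≼_ _≗_ : Expr → Expr → Formula
    _and_ _or_ _implies_ : Formula → Formula → Formula

  _≺_ : Expr → Expr → Formula
  e ≺ f = lit 1ℤ ⊕ e ≼ f

  _‼_ : List ℤ → ℕ → ℤ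
  [] ‼ _ = 0ℤ
  (x ∷ _) ‼ zero = x
  (_ ∷ ρ) ‼ suc i = ρ ‼ i

  -- Repeated addition makes `multiple 6 (+ m)` reduce to `+ (6 * m)`, so that formulas match the
  -- statement of the theorem definitionally; the product of integers would be stuck on the sign.
  multiple : ℕ → ℤ → ℤ
  multiple zero x = 0ℤ
  multiple (suc k) x = x + multiple k x

  ⟦_⟧ᵉ : Expr → List ℤ → ℤ
  ⟦ var i ⟧ᵉ ρ = ρ ‼ i
  ⟦ lit k ⟧ᵉ ρ = k
  ⟦ e ⊕ f ⟧ᵉ ρ = ⟦ e ⟧ᵉ ρ + ⟦ f ⟧ᵉ ρ
  ⟦ e ⊖ f ⟧ᵉ ρ = ⟦ e ⟧ᵉ ρ - ⟦ f ⟧ᵉ ρ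
  ⟦ ⊝ e ⟧ᵉ ρ = - ⟦ e ⟧ᵉ ρ
  ⟦ k ⊛ e ⟧ᵉ ρ = multiple k (⟦ e ⟧ᵉ ρ)

  ⟦_⟧ : Formula → List ℤ → Set
  ⟦ e ≼ f ⟧ ρ = ⟦ e ⟧ᵉ ρ ≤ ⟦ f ⟧ᵉ ρ
  ⟦ e ≗ f ⟧ ρ = ⟦ e ⟧ᵉ ρ ≡ ⟦ f ⟧ᵉ ρ
  ⟦ P and Q ⟧ ρ = ⟦ P ⟧ ρ × ⟦ Q ⟧ ρ
  ⟦ P or Q ⟧ ρ = ⟦ P ⟧ ρ ⊎ ⟦ Q ⟧ ρ
  ⟦ P implies Q ⟧ ρ = ⟦ P ⟧ ρ → ⟦ Q ⟧ ρ

  row : Expr → Row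
  row (var i) = replicate (suc i) 0ℤ ++ 1ℤ ∷ []
  row (lit k) = k ∷ []
  row (e ⊕ f) = combine 1ℤ (row e) 1ℤ (row f)
  row (e ⊖ f) = combine 1ℤ (row e) (- 1ℤ) (row f)
  row (⊝ e) = scale (- 1ℤ) (row e)
  row (k ⊛ e) = scale (+ k) (row e)

  multiple-* : ∀ k x → + k * x ≡ multiple k x
  multiple-* zero x = refl
  multiple-* (suc k) x = trans (ℤ.*-distribʳ-+ x 1ℤ (+ k)) (cong₂ _+_ (ℤ.*-identityˡ x) (multiple-* k x))

  row-∙ : ∀ e ρ → row e ∙ (1ℤ ∷ ρ) ≡ ⟦ e ⟧ᵉ ρ
  row-∙ (var i) ρ = trans (ℤ.+-identityˡ _) (unit i ρ)
    where
      unit : ∀ i ρ → (replicate i 0ℤ ++ 1ℤ ∷ []) ∙ ρ ≡ ρ ‼ i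
      unit zero [] = refl
      unit (suc i) [] = refl
      unit zero (x ∷ ρ) = trans (ℤ.+-identityʳ _) (ℤ.*-identityˡ x)
      unit (suc i) (x ∷ ρ) = trans (ℤ.+-identityˡ _) (unit i ρ)
  row-∙ (lit k) ρ = trans (ℤ.+-identityʳ _) (ℤ.*-identityʳ k)
  row-∙ (e ⊕ f) ρ rewrite combine-∙ 1ℤ (row e) 1ℤ (row f) (1ℤ ∷ ρ) | row-∙ e ρ | row-∙ f ρ =
    cong₂ _+_ (ℤ.*-identityˡ (⟦ e ⟧ᵉ ρ)) (ℤ.*-identityˡ (⟦ f ⟧ᵉ ρ))
  row-∙ (e ⊖ f) ρ rewrite combine-∙ 1ℤ (row e) (- 1ℤ) (row f) (1ℤ ∷ ρ) | row-∙ e ρ | row-∙ f ρ =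
    cong₂ _+_ (ℤ.*-identityˡ (⟦ e ⟧ᵉ ρ)) (ℤ.-1*i≡-i (⟦ f ⟧ᵉ ρ))
  row-∙ (⊝ e) ρ rewrite scale-∙ (- 1ℤ) (row e) (1ℤ ∷ ρ) | row-∙ e ρ = ℤ.-1*i≡-i _
  row-∙ (k ⊛ e) ρ rewrite scale-∙ (+ k) (row e) (1ℤ ∷ ρ) | row-∙ e ρ = multiple-* k _

  data NF : Set where
    ge0 eq0 : Row → NF
    _∧ⁿ_ _∨ⁿ_ : NF → NF → NF

  Sat : List ℤ → NF → Set
  Sat ρ (ge0 p) = ρ ⊨ p ≥0
  Sat ρ (eq0 p) = ρ ⊨ p =0
  Sat ρ (a ∧ⁿ b) = Sat ρ a × Sat ρ b
  Sat ρ (a ∨ⁿ b) = Sat ρ a ⊎ Sat ρ b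

  -- Negation is pushed down to the atoms, where over the integers x > y becomes x - y - 1 ≥ 0 and x
  -- ≠ y splits in two. The classical reading of implication is justified by `decide`.
  asserted denied : Formula → NF
  asserted (e ≼ f) = ge0 (row (f ⊖ e))
  asserted (e ≗ f) = eq0 (row (f ⊖ e))
  asserted (P and Q) = asserted P ∧ⁿ asserted Q
  asserted (P or Q) = asserted P ∨ⁿ asserted Q
  asserted (P implies Q) = denied P ∨ⁿ asserted Q
  denied (e ≼ f) = ge0 (row (e ⊖ f ⊖ lit 1ℤ))
  denied (e ≗ f) = ge0 (row (e ⊖ f ⊖ lit 1ℤ)) ∨ⁿ ge0 (row (f ⊖ e ⊖ lit 1ℤ))
  denied (P and Q) = denied P ∨ⁿ denied Q
  denied (P or Q) = denied P ∧ⁿ denied Q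
  denied (P implies Q) = asserted P ∧ⁿ denied Q

  ≰⇒0≤ : ∀ {x y} → y < x → 0ℤ ≤ x - y - 1ℤ
  ≰⇒0≤ {x} {y} h = subst (0ℤ ≤_) (lemma x y) (ℤ.i≤j⇒0≤j-i (ℤ.i<j⇒suc[i]≤j h))
    where
      lemma : ∀ x y → x - (1ℤ + y) ≡ x - y - 1ℤ
      lemma = solve-∀

  assert : ∀ P {ρ} → ⟦ P ⟧ ρ → Sat ρ (asserted P)
  decide : ∀ P ρ → ⟦ P ⟧ ρ ⊎ Sat ρ (denied P)

  assert (e ≼ f) {ρ} h = subst (0ℤ ≤_) (sym (row-∙ (f ⊖ e) ρ)) (ℤ.i≤j⇒0≤j-i h)
  assert (e ≗ f) {ρ} h = sym (trans (row-∙ (f ⊖ e) ρ) (ℤ.i≡j⇒i-j≡0 (sym h)))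
  assert (P and Q) (p , q) = assert P p , assert Q q
  assert (P or Q) (inj₁ p) = inj₁ (assert P p)
  assert (P or Q) (inj₂ q) = inj₂ (assert Q q)
  assert (P implies Q) {ρ} h with decide P ρ
  ... | inj₁ p = inj₂ (assert Q (h p))
  ... | inj₂ np = inj₁ np

  clash : ∀ P {ρ} → ⟦ P ⟧ ρ → Sat ρ (denied P) → ⊥
  refutes : ∀ P {ρ} → Sat ρ (asserted P) → Sat ρ (denied P) → ⊥

  negative : ∀ {ρ} e f → ⟦ e ⟧ᵉ ρ ≤ ⟦ f ⟧ᵉ ρ → ρ ⊨ row (e ⊖ f ⊖ lit 1ℤ) ≥0 → ⊥
  negative {ρ} e f h h′ = ℤ.<-irrefl refl (ℤ.<-≤-trans (ℤ.suc[i]≤j⇒i<j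
      (ℤ.0≤i-j⇒j≤i (subst (0ℤ ≤_) (trans (row-∙ (e ⊖ f ⊖ lit 1ℤ) ρ) (lemma (⟦ e ⟧ᵉ ρ) (⟦ f ⟧ᵉ ρ))) h′))) h)
    where
      lemma : ∀ x y → x - y - 1ℤ ≡ x - (1ℤ + y)
      lemma = solve-∀

  clash P p = refutes P (assert P p)

  refutes (e ≼ f) {ρ} h h′ = negative e f (ℤ.0≤i-j⇒j≤i (subst (0ℤ ≤_) (row-∙ (f ⊖ e) ρ) h)) h′
  refutes (e ≗ f) {ρ} h h′ with ℤ.i-j≡0⇒i≡j (⟦ f ⟧ᵉ ρ) (⟦ e ⟧ᵉ ρ) (trans (sym (row-∙ (f ⊖ e) ρ)) (sym h)) | h′
  ... | eq | inj₁ l = negative e f (ℤ.≤-reflexive (sym eq)) l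
  ... | eq | inj₂ l = negative f e (ℤ.≤-reflexive eq) l
  refutes (P and Q) (p , q) (inj₁ np) = refutes P p np
  refutes (P and Q) (p , q) (inj₂ nq) = refutes Q q nq
  refutes (P or Q) (inj₁ p) (np , nq) = refutes P p np
  refutes (P or Q) (inj₂ q) (np , nq) = refutes Q q nq
  refutes (P implies Q) (inj₁ np) (p , nq) = refutes P p np
  refutes (P implies Q) (inj₂ q) (p , nq) = refutes Q q nq

  decide (e ≼ f) ρ with ⟦ e ⟧ᵉ ρ ℤ.≤? ⟦ f ⟧ᵉ ρ
  ... | yes h = inj₁ h
  ... | no ¬h = inj₂ (subst (0ℤ ≤_) (sym (row-∙ (e ⊖ f ⊖ lit 1ℤ) ρ)) (≰⇒0≤ (ℤ.≰⇒> ¬h)))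
  decide (e ≗ f) ρ with ⟦ e ⟧ᵉ ρ ℤ.≤? ⟦ f ⟧ᵉ ρ | ⟦ f ⟧ᵉ ρ ℤ.≤? ⟦ e ⟧ᵉ ρ
  ... | yes h | yes h′ = inj₁ (ℤ.≤-antisym h h′)
  ... | no ¬h | _ = inj₂ (inj₁ (subst (0ℤ ≤_) (sym (row-∙ (e ⊖ f ⊖ lit 1ℤ) ρ)) (≰⇒0≤ (ℤ.≰⇒> ¬h))))
  ... | yes _ | no ¬h = inj₂ (inj₂ (subst (0ℤ ≤_) (sym (row-∙ (f ⊖ e ⊖ lit 1ℤ) ρ)) (≰⇒0≤ (ℤ.≰⇒> ¬h))))
  decide (P and Q) ρ with decide P ρ | decide Q ρ
  ... | inj₁ p | inj₁ q = inj₁ (p , q)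
  ... | inj₂ np | _ = inj₂ (inj₁ np)
  ... | inj₁ _ | inj₂ nq = inj₂ (inj₂ nq)
  decide (P or Q) ρ with decide P ρ | decide Q ρ
  ... | inj₁ p | _ = inj₁ (inj₁ p)
  ... | inj₂ _ | inj₁ q = inj₁ (inj₂ q)
  ... | inj₂ np | inj₂ nq = inj₂ (np , nq)
  decide (P implies Q) ρ with decide P ρ | decide Q ρ
  ... | _ | inj₁ q = inj₁ (λ _ → q)
  ... | inj₁ p | inj₂ nq = inj₂ (assert P p , nq)
  ... | inj₂ np | inj₂ _ = inj₁ (λ p → ⊥-elim (clash P p np))

  -- Case splits are postponed, and only made once the literals alone are seen to be feasible.

  search : ℕ → List Row → List Row → List (NF × NF) → List NF → Bool
  branch : ℕ → List Row → List Row → List (NF × NF) → NF → NF → Bool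

  search zero _ _ _ _ = false
  search (suc f) es ps cs (ge0 p ∷ t) = search f es (p ∷ ps) cs t
  search (suc f) es ps cs (eq0 e ∷ t) = search f (e ∷ es) ps cs t
  search (suc f) es ps cs ((a ∧ⁿ b) ∷ t) = search f es ps cs (a ∷ b ∷ t)
  search (suc f) es ps cs ((a ∨ⁿ b) ∷ t) = search f es ps ((a , b) ∷ cs) t
  search (suc f) es ps [] [] = infeasible es ps
  search (suc f) es ps ((a , b) ∷ cs) [] = infeasible es ps ∨ branch f es ps cs a b

  branch zero _ _ _ _ _ = false
  -- Reassociation to the right makes nested disjunctions a single list of cases.
  branch (suc f) es ps cs (a ∨ⁿ a′) b = branch f es ps cs a (a′ ∨ⁿ b)
  branch (suc f) es ps cs a (b ∨ⁿ b′) = search f es ps cs (a ∷ []) ∧ branch f es ps cs b b′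
  branch (suc f) es ps cs a b = search f es ps cs (a ∷ []) ∧ search f es ps cs (b ∷ [])

  SatPair : List ℤ → NF × NF → Set
  SatPair ρ (a , b) = Sat ρ a ⊎ Sat ρ b

  true∧ : ∀ a {b} → (a ∧ b) ≡ true → a ≡ true × b ≡ true
  true∧ true eq = refl , eq

  search-sound : ∀ {ρ} f es ps cs t → search f es ps cs t ≡ true →
    All (ρ ⊨_=0) es → All (ρ ⊨_≥0) ps → All (SatPair ρ) cs → All (Sat ρ) t → ⊥
  branch-sound : ∀ {ρ} f es ps cs a b → branch f es ps cs a b ≡ true →
    All (ρ ⊨_=0) es → All (ρ ⊨_≥0) ps → All (SatPair ρ) cs → SatPair ρ (a , b) → ⊥
  leaf-sound : ∀ {ρ} f es ps cs a b → (search f es ps cs (a ∷ []) ∧ search f es ps cs (b ∷ [])) ≡ true →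
    All (ρ ⊨_=0) es → All (ρ ⊨_≥0) ps → All (SatPair ρ) cs → SatPair ρ (a , b) → ⊥
  right-sound : ∀ {ρ} f es ps cs a b b′ → (search f es ps cs (a ∷ []) ∧ branch f es ps cs b b′) ≡ true →
    All (ρ ⊨_=0) es → All (ρ ⊨_≥0) ps → All (SatPair ρ) cs → SatPair ρ (a , b ∨ⁿ b′) → ⊥

  search-sound (suc f) es ps cs (ge0 p ∷ t) eq hes hps hcs (h ∷ ht) = search-sound f es (p ∷ ps) cs t eq hes (h ∷ hps) hcs ht
  search-sound (suc f) es ps cs (eq0 e ∷ t) eq hes hps hcs (h ∷ ht) = search-sound f (e ∷ es) ps cs t eq (h ∷ hes) hps hcs ht
  search-sound (suc f) es ps cs ((a ∧ⁿ b) ∷ t) eq hes hps hcs ((h , h′) ∷ ht) = search-sound f es ps cs (a ∷ b ∷ t) eq hes hps hcs (h ∷ h′ ∷ ht)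
  search-sound (suc f) es ps cs ((a ∨ⁿ b) ∷ t) eq hes hps hcs (h ∷ ht) = search-sound f es ps ((a , b) ∷ cs) t eq hes hps (h ∷ hcs) ht
  search-sound (suc f) es ps [] [] eq hes hps _ _ = infeasible-sound es ps eq hes hps
  search-sound (suc f) es ps ((a , b) ∷ cs) [] eq hes hps (h ∷ hcs) _ with infeasible es ps in i
  ... | true = infeasible-sound es ps i hes hps
  ... | false = branch-sound f es ps cs a b eq hes hps hcs h

  leaf-sound f es ps cs a b eq hes hps hcs h with true∧ (search f es ps cs (a ∷ [])) eq | h
  ... | l , r | inj₁ ha = search-sound f es ps cs (a ∷ []) l hes hps hcs (ha ∷ [])
  ... | l , r | inj₂ hb = search-sound f es ps cs (b ∷ []) r hes hps hcs (hb ∷ [])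

  right-sound f es ps cs a b b′ eq hes hps hcs h with true∧ (search f es ps cs (a ∷ [])) eq | h
  ... | l , r | inj₁ ha = search-sound f es ps cs (a ∷ []) l hes hps hcs (ha ∷ [])
  ... | l , r | inj₂ hb = branch-sound f es ps cs b b′ r hes hps hcs hb

  branch-sound (suc f) es ps cs (a ∨ⁿ a′) b eq hes hps hcs (inj₁ (inj₁ h)) = branch-sound f es ps cs a (a′ ∨ⁿ b) eq hes hps hcs (inj₁ h)
  branch-sound (suc f) es ps cs (a ∨ⁿ a′) b eq hes hps hcs (inj₁ (inj₂ h)) = branch-sound f es ps cs a (a′ ∨ⁿ b) eq hes hps hcs (inj₂ (inj₁ h))
  branch-sound (suc f) es ps cs (a ∨ⁿ a′) b eq hes hps hcs (inj₂ h) = branch-sound f es ps cs a (a′ ∨ⁿ b) eq hes hps hcs (inj₂ (inj₂ h))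
  -- `branch` reduces only once the shapes of both disjuncts are known, hence the enumeration.
  branch-sound (suc f) es ps cs a@(ge0 _) (b ∨ⁿ b′) eq hes hps hcs h = right-sound f es ps cs a b b′ eq hes hps hcs h
  branch-sound (suc f) es ps cs a@(eq0 _) (b ∨ⁿ b′) eq hes hps hcs h = right-sound f es ps cs a b b′ eq hes hps hcs h
  branch-sound (suc f) es ps cs a@(_ ∧ⁿ _) (b ∨ⁿ b′) eq hes hps hcs h = right-sound f es ps cs a b b′ eq hes hps hcs h
  branch-sound (suc f) es ps cs a@(ge0 _) b@(ge0 _) eq hes hps hcs h = leaf-sound f es ps cs a b eq hes hps hcs h
  branch-sound (suc f) es ps cs a@(ge0 _) b@(eq0 _) eq hes hps hcs h = leaf-sound f es ps cs a b eq hes hps hcs h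
  branch-sound (suc f) es ps cs a@(ge0 _) b@(_ ∧ⁿ _) eq hes hps hcs h = leaf-sound f es ps cs a b eq hes hps hcs h
  branch-sound (suc f) es ps cs a@(eq0 _) b@(ge0 _) eq hes hps hcs h = leaf-sound f es ps cs a b eq hes hps hcs h
  branch-sound (suc f) es ps cs a@(eq0 _) b@(eq0 _) eq hes hps hcs h = leaf-sound f es ps cs a b eq hes hps hcs h
  branch-sound (suc f) es ps cs a@(eq0 _) b@(_ ∧ⁿ _) eq hes hps hcs h = leaf-sound f es ps cs a b eq hes hps hcs h
  branch-sound (suc f) es ps cs a@(_ ∧ⁿ _) b@(ge0 _) eq hes hps hcs h = leaf-sound f es ps cs a b eq hes hps hcs h
  branch-sound (suc f) es ps cs a@(_ ∧ⁿ _) b@(eq0 _) eq hes hps hcs h = leaf-sound f es ps cs a b eq hes hps hcs h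
  branch-sound (suc f) es ps cs a@(_ ∧ⁿ _) b@(_ ∧ⁿ _) eq hes hps hcs h = leaf-sound f es ps cs a b eq hes hps hcs h

  valid : Formula → Bool
  valid P = search 1000 [] [] [] (denied P ∷ [])

  abstract
    -- `valid` stays transparent and is evaluated by `refl`; being abstract keeps the resulting
    -- proofs from ever being unfolded.
    lia : ∀ P → valid P ≡ true → ∀ ρ → ⟦ P ⟧ ρ
    lia P eq ρ with decide P ρ
    ... | inj₁ p = p
    ... | inj₂ np = ⊥-elim (search-sound 1000 [] [] [] (denied P ∷ []) eq [] [] [] (np ∷ []))

open LinearArithmetic

-- The regions and the linear statements about them

module Symbolic where

  -- The words (0,a,b,c) are cut into regions on which dinv is affine: A for m < b, c; B for c ≤ m < b;
  -- C for b ≤ m < c; D for b, c ≤ m, where the three digits record whether a > b, a > c, b > c.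

  data Region : Set where
    A₁ A₂ A₃ B₁ B₂ B₃ C₁ C₂ C₃ D₀₀₀ D₀₁₁ D₁₁₀ D₀₀₁ D₁₀₀ D₁₁₁ : Region

  regions : List Region
  regions = A₁ ∷ A₂ ∷ A₃ ∷ B₁ ∷ B₂ ∷ B₃ ∷ C₁ ∷ C₂ ∷ C₃ ∷ D₀₀₀ ∷ D₀₁₁ ∷ D₁₁₀ ∷ D₀₀₁ ∷ D₁₀₀ ∷ D₁₁₁ ∷ []

  pick : ∀ {Q : Region → Set} → All Q regions → ∀ r → Q r
  pick (a₁ ∷ a₂ ∷ a₃ ∷ b₁ ∷ b₂ ∷ b₃ ∷ c₁ ∷ c₂ ∷ c₃ ∷ d₁ ∷ d₂ ∷ d₃ ∷ d₄ ∷ d₅ ∷ d₆ ∷ []) =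
    λ { A₁ → a₁ ; A₂ → a₂ ; A₃ → a₃ ; B₁ → b₁ ; B₂ → b₂ ; B₃ → b₃ ; C₁ → c₁ ; C₂ → c₂ ; C₃ → c₃
      ; D₀₀₀ → d₁ ; D₀₁₁ → d₂ ; D₁₁₀ → d₃ ; D₀₀₁ → d₄ ; D₁₀₀ → d₅ ; D₁₁₁ → d₆ }

  every : ∀ p → all p regions ≡ true → ∀ r → p r ≡ true
  every p eq r = Equivalence.to T-≡ (pick (All.all⁺ p regions (Equivalence.from T-≡ eq)) r)

  lia-regions : ∀ (P : Region → Formula) → all (valid ∘ P) regions ≡ true → ∀ r ρ → ⟦ P r ⟧ ρ
  lia-regions P eq r = lia (P r) (every (valid ∘ P) eq r)

  lia-regions² : ∀ (P : Region → Region → Formula) → all (λ r → all (λ s → valid (P r s)) regions) regions ≡ true → ∀ r s ρ → ⟦ P r s ⟧ ρ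
  lia-regions² P eq r = lia-regions (P r) (every (λ r → all (λ s → valid (P r s)) regions) eq r)

  pattern # n = lit (+ n)

  m E ε j k μ a b c : Expr
  m = var 0
  E = var 1
  ε = var 2
  j = var 3
  k = var 4
  μ = var 5
  a = var 6
  b = var 7
  c = var 8

  -- Writing e = 6m - j - k = 2E + ε for the defect and μ = max(k, e), the words of a fibre are numbered
  -- consecutively by the index below. It was found by following the words of a fibre as k grows.
  -- The four regions B₁, B₂, C₂, C₃ take turns, and so do the three D's of either parity of e, and B₃ and C₁:
  -- whence the slopes 4, 3, 2 and the different offsets.
  module _ (a b c : Expr) where

    cond : Region → Formula
    cond A₁ = m ≺ b and # 0 ≼ a and a ≼ m and b ≼ a ⊕ m and b ≼ c and c ≼ b ⊕ m and a ⊕ m ≺ c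
    cond A₂ = m ≺ b and # 0 ≼ a and a ≼ m and b ≼ a ⊕ m and b ≼ c and c ≼ a ⊕ m
    cond A₃ = m ≺ c and # 0 ≼ a and a ≼ m and b ≼ a ⊕ m and c ≺ b
    cond B₁ = m ≺ b and c ≼ m and # 0 ≼ a and a ≼ c and b ≼ a ⊕ m
    cond B₂ = m ≺ b and # 0 ≼ c and a ≼ m and c ≺ a and b ≼ c ⊕ m
    cond B₃ = # 0 ≼ c and a ≼ m and c ≺ a and c ⊕ m ≺ b and b ≼ a ⊕ m
    cond C₁ = # 0 ≼ a and a ≼ b and b ≼ m and a ⊕ m ≺ c and c ≼ b ⊕ m
    cond C₂ = m ≺ c and # 0 ≼ a and a ≼ b and b ≼ m and c ≼ a ⊕ m
    cond C₃ = m ≺ c and # 0 ≼ b and a ≼ m and b ≺ a and c ≼ b ⊕ m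
    cond D₀₀₀ = # 0 ≼ a and a ≼ b and b ≼ c and c ≼ m
    cond D₀₁₁ = # 0 ≼ c and c ≺ a and a ≼ b and b ≼ m
    cond D₁₁₀ = # 0 ≼ b and b ≼ c and c ≺ a and a ≼ m
    cond D₀₀₁ = # 0 ≼ a and a ≼ c and c ≺ b and b ≼ m
    cond D₁₀₀ = # 0 ≼ b and b ≺ a and a ≼ c and c ≼ m
    cond D₁₁₁ = # 0 ≼ c and c ≺ b and b ≺ a and a ≼ m

    dinvᵉ : Region → Expr
    dinvᵉ A₁ = 3 ⊛ m ⊖ c
    dinvᵉ A₂ = 4 ⊛ m ⊖ 2 ⊛ c ⊕ a
    dinvᵉ A₃ = 4 ⊛ m ⊕ # 1 ⊖ 2 ⊛ b ⊕ a
    dinvᵉ B₁ = 5 ⊛ m ⊕ # 1 ⊖ 2 ⊛ b ⊕ a ⊖ c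
    dinvᵉ B₂ = 5 ⊛ m ⊕ # 2 ⊖ 2 ⊛ b ⊖ a ⊕ c
    dinvᵉ B₃ = 4 ⊛ m ⊕ # 1 ⊖ a ⊖ b
    dinvᵉ C₁ = 4 ⊛ m ⊖ b ⊖ c
    dinvᵉ C₂ = 5 ⊛ m ⊖ b ⊖ 2 ⊛ c ⊕ a
    dinvᵉ C₃ = 5 ⊛ m ⊕ # 1 ⊖ a ⊕ b ⊖ 2 ⊛ c
    dinvᵉ D₀₀₀ = 6 ⊛ m ⊕ a ⊖ b ⊖ 3 ⊛ c
    dinvᵉ D₀₁₁ = 6 ⊛ m ⊕ # 2 ⊖ a ⊖ 3 ⊛ b ⊕ c
    dinvᵉ D₁₁₀ = 6 ⊛ m ⊕ # 2 ⊖ 3 ⊛ a ⊕ b ⊖ c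
    dinvᵉ D₀₀₁ = 6 ⊛ m ⊕ # 1 ⊕ a ⊖ 3 ⊛ b ⊖ c
    dinvᵉ D₁₀₀ = 6 ⊛ m ⊕ # 1 ⊖ a ⊕ b ⊖ 3 ⊛ c
    dinvᵉ D₁₁₁ = 6 ⊛ m ⊕ # 3 ⊖ 3 ⊛ a ⊖ b ⊕ c

    index : Region → Expr
    index A₁ = a ⊖ m ⊕ E
    index A₂ = a ⊖ m ⊕ E
    index A₃ = a ⊖ m ⊕ E
    index B₁ = 4 ⊛ a ⊕ # 1 ⊕ (k ⊖ 7 ⊛ m ⊕ 5 ⊛ E ⊕ 2 ⊛ ε)
    index B₂ = 4 ⊛ c ⊕ # 3 ⊕ (k ⊖ 7 ⊛ m ⊕ 5 ⊛ E ⊕ 2 ⊛ ε)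
    index B₃ = 3 ⊛ m ⊕ E ⊖ μ ⊕ # 1 ⊖ 2 ⊛ a
    index C₁ = 3 ⊛ m ⊕ E ⊖ μ ⊖ 2 ⊛ b
    index C₂ = 4 ⊛ a ⊕ (k ⊖ 7 ⊛ m ⊕ 5 ⊛ E ⊕ 2 ⊛ ε)
    index C₃ = 4 ⊛ b ⊕ # 2 ⊕ (k ⊖ 7 ⊛ m ⊕ 5 ⊛ E ⊕ 2 ⊛ ε)
    index D₀₀₀ = 3 ⊛ a ⊖ j ⊕ 2 ⊛ E
    index D₀₁₁ = 3 ⊛ c ⊕ # 2 ⊖ j ⊕ 2 ⊛ E
    index D₁₁₀ = 3 ⊛ b ⊕ # 1 ⊖ j ⊕ 2 ⊛ E
    index D₀₀₁ = 3 ⊛ a ⊕ # 1 ⊖ j ⊕ 2 ⊛ E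
    index D₁₀₀ = 3 ⊛ b ⊕ # 2 ⊖ j ⊕ 2 ⊛ E
    index D₁₁₁ = 3 ⊛ c ⊕ # 3 ⊖ j ⊕ 2 ⊛ E

    member : Region → Formula
    member r = cond r and j ≗ a ⊕ b ⊕ c and k ≗ dinvᵉ r

  isWord : Formula
  isWord = # 0 ≼ a and a ≼ m and # 0 ≼ b and b ≼ a ⊕ m and # 0 ≼ c and c ≼ b ⊕ m

  some : (Region → Formula) → List Region → Formula
  some P [] = # 1 ≼ # 0
  some P (r ∷ []) = P r
  some P (r ∷ rs@(_ ∷ _)) = P r or some P rs

  some-elim : ∀ {P ρ} rs → ⟦ some P rs ⟧ ρ → ∃[ r ] ⟦ P r ⟧ ρ
  some-elim [] (+≤+ ())
  some-elim (r ∷ []) p = r , p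
  some-elim (r ∷ _ ∷ _) (inj₁ p) = r , p
  some-elim (_ ∷ s ∷ rs) (inj₂ q) = some-elim (s ∷ rs) q

  cond-exhaustiveᶠ : Formula
  cond-exhaustiveᶠ = isWord implies some (cond a b c) regions

  cond-exhaustive : ∀ ρ → ⟦ isWord ⟧ ρ → ∃[ r ] ⟦ cond a b c r ⟧ ρ
  cond-exhaustive ρ h = some-elim regions (lia cond-exhaustiveᶠ refl ρ h)

  -- The conditions of distinct regions are incompatible, so off the diagonal the premises clash.
  -- This makes the index a function of the word.
  index-functionalᶠ : Region → Region → Formula
  index-functionalᶠ r s = cond a b c r implies cond a b c s implies index a b c r ≗ index a b c s

  index-functional : ∀ r s ρ → ⟦ index-functionalᶠ r s ⟧ ρ
  index-functional = lia-regions² index-functionalᶠ refl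

  -- The graph of `sc`. Formulas have no conditionals, so each value of `sc` is a fresh variable
  -- tied to its argument by these cases.
  scSpec : Expr → Expr → Formula
  scSpec p v =
    (# 1 ≼ p and p ≼ m and v ≗ m ⊕ # 1 ⊖ p) or
    (⊝ m ≼ p and p ≼ # 0 and v ≗ m ⊕ p) or
    (m ≺ p and v ≗ # 0) or
    (p ≺ ⊝ m and v ≗ # 0)

  dinvᵉ-correctᶠ : Region → Formula
  dinvᵉ-correctᶠ r = cond a b c r implies
    scSpec (# 0 ⊖ a) (var 9) implies scSpec (# 0 ⊖ b) (var 10) implies scSpec (# 0 ⊖ c) (var 11) implies
    scSpec (a ⊖ b) (var 12) implies scSpec (a ⊖ c) (var 13) implies scSpec (b ⊖ c) (var 14) implies
    var 9 ⊕ var 10 ⊕ var 11 ⊕ var 12 ⊕ var 13 ⊕ var 14 ≗ dinvᵉ a b c r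

  dinvᵉ-correct : ∀ r ρ → ⟦ dinvᵉ-correctᶠ r ⟧ ρ
  dinvᵉ-correct = lia-regions dinvᵉ-correctᶠ refl

  cond⇒isWordᶠ : Region → Formula
  cond⇒isWordᶠ r = cond a b c r implies isWord

  cond⇒isWord : ∀ r ρ → ⟦ cond⇒isWordᶠ r ⟧ ρ
  cond⇒isWord = lia-regions cond⇒isWordᶠ refl

  degree≥4mᶠ : Region → Formula
  degree≥4mᶠ r = member a b c r implies 4 ⊛ m ≼ j ⊕ k

  degree≥4m : ∀ r ρ → ⟦ degree≥4mᶠ r ⟧ ρ
  degree≥4m = lia-regions degree≥4mᶠ refl

  -- Degree 4m is reached only in `C₁`, where j + k = 4m + a, and in `D₀₀₀`, where j + k = 6m + 2a -
  -- 2c.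
  degree≡4mᶠ : Region → Formula
  degree≡4mᶠ r = member a b c r implies j ⊕ k ≗ 4 ⊛ m implies a ≗ # 0 and b ≼ m and m ≼ c

  degree≡4m : ∀ r ρ → ⟦ degree≡4mᶠ r ⟧ ρ
  degree≡4m = lia-regions degree≡4mᶠ refl

  degree≡4m⁻¹ᶠ : Region → Formula
  degree≡4m⁻¹ᶠ r = cond a b c r implies a ≗ # 0 and b ≼ m and m ≼ c implies b ⊕ c ⊕ dinvᵉ a b c r ≗ 4 ⊛ m

  degree≡4m⁻¹ : ∀ r ρ → ⟦ degree≡4m⁻¹ᶠ r ⟧ ρ
  degree≡4m⁻¹ = lia-regions degree≡4m⁻¹ᶠ refl

  e : Expr
  e = 2 ⊛ E ⊕ ε

  -- Halving and maximum in linear form; `e ≺ 2 ⊛ m` is j + k > 4m. The two upper bounds of `window`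
  -- combine to i ≤ E + k - μ, the end from which `B₃` and `C₁` are counted down.
  base isMax : Formula
  base = 6 ⊛ m ≗ j ⊕ k ⊕ e and # 0 ≼ ε and ε ≼ # 1 and e ≺ 2 ⊛ m
  isMax = (μ ≗ k and e ≼ k) or (μ ≗ e and k ≼ e)

  -- The third bound is i ≤ k - ⌈e/2⌉, since e - E = ⌈e/2⌉.
  window : Expr → Formula
  window i = # 0 ≼ i and i ≼ E and i ⊕ e ≼ k ⊕ E and e ≼ i ⊕ j

  index-windowᶠ : Region → Formula
  index-windowᶠ r = base implies isMax implies member a b c r implies window (index a b c r)

  index-window : ∀ r ρ → ⟦ index-windowᶠ r ⟧ ρ
  index-window = lia-regions index-windowᶠ refl

  -- In one region, area, dinv and index determine the three letters. Regions of one group are told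
  -- apart by congruences or by the range of the index, different groups by that range.
  index-injectiveᶠ : Region → Region → Formula
  index-injectiveᶠ r s = let a′ = var 9; b′ = var 10; c′ = var 11 in
    base implies isMax implies member a b c r implies member a′ b′ c′ s implies
      index a b c r ≗ index a′ b′ c′ s implies a ≗ a′ and b ≗ b′ and c ≗ c′

  index-injective : ∀ r s ρ → ⟦ index-injectiveᶠ r s ⟧ ρ
  index-injective = lia-regions² index-injectiveᶠ refl

  -- `κ` is four times a letter plus 0, 1, 2, 3 on `C₂`, `B₁`, `C₃`, `B₂`; `τ` is 2b on `C₁` and 2a
  -- - 1 on `B₃`. Their residues modulo 4 and 2 name the region.
  i y κ τ : Expr
  i = var 9
  y = var 10
  κ = i ⊖ (k ⊖ 7 ⊛ m ⊕ 5 ⊛ E ⊕ 2 ⊛ ε)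
  τ = 3 ⊛ m ⊕ E ⊖ μ ⊖ i

  -- For which i the word with index i lies in a given group of regions.
  inD inA₁ inA₂₃ inB₁₂C₂₃ inB₃C₁ : Formula
  inD = i ⊕ j ⊕ E ⊕ ε ≼ 3 ⊛ m
  inA₁ = k ⊕ i ≺ m ⊕ E and i ⊕ E ⊕ ε ≺ m
  inA₂₃ = m ⊕ E ≼ k ⊕ i and 3 ⊛ i ⊕ E ⊕ k ⊕ 2 ⊛ ε ⊕ # 2 ≼ 3 ⊛ m
  inB₁₂C₂₃ = 4 ⊛ m ≺ κ ⊕ 2 ⊛ e and 4 ⊛ j ≼ 3 ⊛ κ ⊕ 4 ⊛ e ⊕ # 1 and κ ⊕ e ≼ j ⊕ m and
    -- Of the values up to 8m only κ + 4e = 8m - 1 is left out: there `B₂` would have b = c + m + 1,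
    -- against `b ≼ c ⊕ m`.
    (κ ⊕ 4 ⊛ e ⊕ # 2 ≼ 8 ⊛ m or κ ⊕ 4 ⊛ e ≗ 8 ⊛ m)
  inB₃C₁ = 4 ⊛ m ≼ τ ⊕ 2 ⊛ e ⊕ # 1 and τ ≼ 2 ⊛ m and 3 ⊛ m ≼ τ ⊕ k and
    -- Only τ + 2k = 2m + 2e is left out: there `C₁` would have c = a + m, against `a ⊕ m ≺ c`.
    (τ ⊕ 2 ⊛ k ≺ 2 ⊛ m ⊕ 2 ⊛ e or τ ⊕ 2 ⊛ k ≗ 2 ⊛ m ⊕ 2 ⊛ e ⊕ # 1)

  window-coveredᶠ : Formula
  window-coveredᶠ = base implies isMax implies # 0 ≼ j implies # 0 ≼ k implies window i implies
    inD or inA₁ or inA₂₃ or inB₁₂C₂₃ or inB₃C₁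

  window-covered : ∀ ρ → ⟦ window-coveredᶠ ⟧ ρ
  window-covered = lia window-coveredᶠ refl

  -- The coordinates of the word with index i, where y is the quotient of a linear form by the slope of the index.
  locus : Region → Formula
  locus A₁ = inA₁ and a ≗ i ⊕ m ⊖ E and b ≗ 2 ⊛ m ⊖ E ⊖ ε ⊖ i and c ≗ 3 ⊛ m ⊖ k
  locus A₂ = inA₂₃ and 5 ⊛ m ⊕ i ⊖ E ⊖ k ≗ # 0 ⊕ 2 ⊛ y and a ≗ i ⊕ m ⊖ E and b ≗ y ⊖ 2 ⊛ i ⊖ ε and c ≗ y
  locus A₃ = inA₂₃ and 5 ⊛ m ⊕ i ⊖ E ⊖ k ≗ # 1 ⊕ 2 ⊛ y and a ≗ i ⊕ m ⊖ E and b ≗ y ⊕ # 1 and c ≗ y ⊖ 2 ⊛ i ⊖ ε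
  locus B₁ = inB₁₂C₂₃ and κ ≗ # 1 ⊕ 4 ⊛ y and a ≗ y and b ≗ e ⊖ m ⊕ # 1 ⊕ 2 ⊛ y and c ≗ j ⊖ a ⊖ b
  locus B₂ = inB₁₂C₂₃ and κ ≗ # 3 ⊕ 4 ⊛ y and c ≗ y and b ≗ e ⊖ m ⊕ # 2 ⊕ 2 ⊛ y and a ≗ j ⊖ b ⊖ c
  locus B₃ = inB₃C₁ and τ ≗ # 1 ⊕ 2 ⊛ y and a ≗ y ⊕ # 1 and b ≗ 4 ⊛ m ⊖ k ⊖ y and c ≗ 2 ⊛ m ⊖ # 1 ⊖ e
  locus C₁ = inB₃C₁ and τ ≗ # 0 ⊕ 2 ⊛ y and a ≗ 2 ⊛ m ⊖ e and b ≗ y and c ≗ 4 ⊛ m ⊖ k ⊖ y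
  locus C₂ = inB₁₂C₂₃ and κ ≗ # 0 ⊕ 4 ⊛ y and a ≗ y and c ≗ e ⊖ m ⊕ 2 ⊛ y and b ≗ j ⊖ a ⊖ c
  locus C₃ = inB₁₂C₂₃ and κ ≗ # 2 ⊕ 4 ⊛ y and b ≗ y and c ≗ e ⊖ m ⊕ # 1 ⊕ 2 ⊛ y and a ≗ j ⊖ b ⊖ c
  locus D₀₀₀ = inD and ε ≗ # 0 and i ⊕ j ⊖ 2 ⊛ E ⊖ ε ≗ # 0 ⊕ 3 ⊛ y and a ≗ y and c ≗ y ⊕ E and b ≗ j ⊖ a ⊖ c
  locus D₁₁₀ = inD and ε ≗ # 0 and i ⊕ j ⊖ 2 ⊛ E ⊖ ε ≗ # 1 ⊕ 3 ⊛ y and b ≗ y and a ≗ y ⊕ E ⊕ # 1 and c ≗ j ⊖ a ⊖ b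
  locus D₀₁₁ = inD and ε ≗ # 0 and i ⊕ j ⊖ 2 ⊛ E ⊖ ε ≗ # 2 ⊕ 3 ⊛ y and c ≗ y and b ≗ y ⊕ E ⊕ # 1 and a ≗ j ⊖ b ⊖ c
  locus D₀₀₁ = inD and ε ≗ # 1 and i ⊕ j ⊖ 2 ⊛ E ⊖ ε ≗ # 0 ⊕ 3 ⊛ y and a ≗ y and b ≗ y ⊕ E ⊕ # 1 and c ≗ j ⊖ a ⊖ b
  locus D₁₀₀ = inD and ε ≗ # 1 and i ⊕ j ⊖ 2 ⊛ E ⊖ ε ≗ # 1 ⊕ 3 ⊛ y and b ≗ y and c ≗ y ⊕ E ⊕ # 1 and a ≗ j ⊖ b ⊖ c
  locus D₁₁₁ = inD and ε ≗ # 1 and i ⊕ j ⊖ 2 ⊛ E ⊖ ε ≗ # 2 ⊕ 3 ⊛ y and c ≗ y and a ≗ y ⊕ E ⊕ # 2 and b ≗ j ⊖ a ⊖ c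

  locus-soundᶠ : Region → Formula
  locus-soundᶠ r = base implies isMax implies # 0 ≼ j implies # 0 ≼ k implies window i implies
    locus r implies member a b c r and i ≗ index a b c r

  locus-sound : ∀ r ρ → ⟦ locus-soundᶠ r ⟧ ρ
  locus-sound = lia-regions locus-soundᶠ refl

open Symbolic hiding (m; E; ε; j; k; μ; a; b; c; e; i; y)

-- Counting

-- Pigeonhole: the partner of the head is removed from `ys`, and injectivity ensures that no later
-- element wants it.
length-≤ : ∀ {A B : Set} (R : A → B → Set) {xs ys} → Unique xs →
  (∀ {x} → x ∈ xs → ∃[ y ] (y ∈ ys × R x y)) →
  (∀ {x x′ y} → x ∈ xs → x′ ∈ xs → R x y → R x′ y → x ≡ x′) → length xs ℕ.≤ length ys
length-≤ R [] _ _ = z≤n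
length-≤ R {x ∷ xs} {ys} (x∉ ∷ u) image injective with image (here refl)
... | y , y∈ys , Rxy with ∈-∃++ y∈ys
...   | us , vs , refl = subst (suc (length xs) ℕ.≤_) (sym (length-++-sucʳ us y vs))
        (s≤s (length-≤ R u image′ (λ p q → injective (there p) (there q))))
  where
    image′ : ∀ {x′} → x′ ∈ xs → ∃[ y′ ] (y′ ∈ us ++ vs × R x′ y′)
    image′ x′∈ with image (there x′∈)
    ... | y′ , y′∈ , Rx′y′ with ∈-++⁻ us y′∈
    ...   | inj₁ p = y′ , ∈-++⁺ˡ p , Rx′y′
    ...   | inj₂ (there p) = y′ , ∈-++⁺ʳ us p , Rx′y′
    ...   | inj₂ (here refl) = ⊥-elim (All.lookup x∉ x′∈ (injective (here refl) (there x′∈) Rxy Rx′y′))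

length-≡ : ∀ {A : Set} (R : A → ℕ → Set) {xs N} → Unique xs →
  (∀ {x} → x ∈ xs → ∃[ t ] (t ℕ.< N × R x t)) →
  (∀ {t} → t ℕ.< N → ∃[ x ] (x ∈ xs × R x t)) →
  (∀ {x x′ t} → x ∈ xs → x′ ∈ xs → R x t → R x′ t → x ≡ x′) →
  (∀ {x t t′} → R x t → R x t′ → t ≡ t′) → length xs ≡ N
length-≡ R {xs} {N} u total onto injective functional = trans
  (ℕ.≤-antisym
    (length-≤ R u (λ p → let t , t<N , r = total p in t , ∈-upTo⁺ t<N , r) injective)
    (length-≤ (λ t x → R x t) (Unique.upTo⁺ N) (onto ∘ ∈-upTo⁻) (λ _ _ → functional)))
  (length-upTo N)

-- `key` recovers the block an element comes from, so distinct blocks are disjoint.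
unique-concatMap : ∀ {A B : Set} (key : B → A) {f : A → List B} {xs} → Unique xs →
  (∀ x → Unique (f x)) → (∀ {x y} → y ∈ f x → key y ≡ x) → Unique (concatMap f xs)
unique-concatMap key [] _ _ = []
unique-concatMap key {f} {x ∷ xs} (x∉ ∷ u) uf keyed = Unique.++⁺ (uf x) (unique-concatMap key u uf keyed)
  λ { (p , q) → let z , z∈xs , q′ = find (∈-concatMap⁻ f {xs = xs} q)
                in All.lookup x∉ z∈xs (trans (sym (keyed p)) (keyed q′)) }

module _ (m : ℕ) where

  private
    words₃ : ℕ → ℕ → List Word4
    words₃ a b = map (word 0 a b) (upTo (suc (b ℕ.+ m)))

    words₂ : ℕ → List Word4
    words₂ a = concatMap (words₃ a) (upTo (suc (a ℕ.+ m)))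

  W4-unique : Unique (W4 m)
  W4-unique = unique-concatMap Word4.γ₁ (Unique.upTo⁺ (suc m))
    (λ a → unique-concatMap Word4.γ₂ (Unique.upTo⁺ (suc (a ℕ.+ m)))
      (λ b → Unique.map⁺ (cong Word4.γ₃) (Unique.upTo⁺ (suc (b ℕ.+ m))))
      (λ p → let _ , _ , eq = ∈-map⁻ (word 0 a _) p in cong Word4.γ₂ eq))
    (λ {a} p → let b , _ , q = find (∈-concatMap⁻ (words₃ a) {xs = upTo (suc (a ℕ.+ m))} p)
                   _ , _ , eq = ∈-map⁻ (word 0 a b) q in cong Word4.γ₁ eq)

  ∈-W4⁻ : ∀ {w} → w ∈ W4 m → ∃[ a ] ∃[ b ] ∃[ c ] (w ≡ word 0 a b c × a ℕ.≤ m × b ℕ.≤ a ℕ.+ m × c ℕ.≤ b ℕ.+ m)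
  ∈-W4⁻ p with find (∈-concatMap⁻ words₂ {xs = upTo (suc m)} p)
  ... | a , a∈ , p₂ with find (∈-concatMap⁻ (words₃ a) {xs = upTo (suc (a ℕ.+ m))} p₂)
  ...   | b , b∈ , p₃ with ∈-map⁻ (word 0 a b) p₃
  ...     | c , c∈ , eq = a , b , c , eq , ℕ.s≤s⁻¹ (∈-upTo⁻ a∈) , ℕ.s≤s⁻¹ (∈-upTo⁻ b∈) , ℕ.s≤s⁻¹ (∈-upTo⁻ c∈)

  ∈-W4⁺ : ∀ {a b c} → a ℕ.≤ m → b ℕ.≤ a ℕ.+ m → c ℕ.≤ b ℕ.+ m → word 0 a b c ∈ W4 m
  ∈-W4⁺ {a} {b} a≤ b≤ c≤ = ∈-concatMap⁺ words₂ (lose (∈-upTo⁺ (s≤s a≤))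
    (∈-concatMap⁺ (words₃ a) (lose (∈-upTo⁺ (s≤s b≤)) (∈-map⁺ (word 0 a b) (∈-upTo⁺ (s≤s c≤))))))

hasDegrees? : ∀ m j k (γ : Word4) → Dec (area γ ≡ j × dinv m γ ≡ k)
hasDegrees? m j k γ = (area γ ℕ.≟ j) ×-dec (dinv m γ ℕ.≟ k)

fibre : ℕ → ℕ → ℕ → List Word4
fibre m j k = filter (hasDegrees? m j k) (W4 m)

fibre-unique : ∀ m j k → Unique (fibre m j k)
fibre-unique m j k = Unique.filter⁺ (hasDegrees? m j k) (W4-unique m)

-- Integer operations

-- A remainder in `Fin n` can be split into numerals, and `multiple` is the meaning of `⊛`, so each
-- case is a linear equation as it stands.
divide : ∀ x n .{{_ : NonZero n}} → ∃[ r ] (x ≡ + toℕ {n} r ℤ.+ multiple n (x /ℕ n))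
divide x n = fromℕ< (ℤ.n%ℕd<d x n) , trans (ℤ.a≡a%ℕn+[a/ℕn]*n x n)
  (cong₂ (λ r q → + r ℤ.+ q) (sym (toℕ-fromℕ< (ℤ.n%ℕd<d x n)))
    (trans (ℤ.*-comm (x /ℕ n) (+ n)) (multiple-* n (x /ℕ n))))

⊔-spec : ∀ x y → (x ⊔ y ≡ x × y ℤ.≤ x) ⊎ (x ⊔ y ≡ y × x ℤ.≤ y)
⊔-spec x y with ℤ.≤-total x y
... | inj₁ h = inj₂ (ℤ.i≤j⇒i⊔j≡j h , h)
... | inj₂ h = inj₁ (ℤ.i≥j⇒i⊔j≡i h , h)

⊓-spec : ∀ x y → (x ⊓ y ≡ x × x ℤ.≤ y) ⊎ (x ⊓ y ≡ y × y ℤ.≤ x)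
⊓-spec x y with ℤ.≤-total x y
... | inj₁ h = inj₁ (ℤ.i≤j⇒i⊓j≡i h , h)
... | inj₂ h = inj₂ (ℤ.i≥j⇒i⊓j≡j h , h)

-- v = max(⌊x/2⌋, 0) with quotient q
halfSpec : Expr → Expr → Expr → Formula
halfSpec x q v = 2 ⊛ q ≼ x and x ≼ # 1 ⊕ 2 ⊛ q and ((v ≗ q and # 0 ≼ q) or (v ≗ # 0 and q ≼ # 0))

half : ∀ x → ⟦ halfSpec (var 0) (var 1) (var 2) ⟧ (x ∷ x /ℕ 2 ∷ floorHalf⁺ x ∷ [])
half x = lower (proj₁ (divide x 2)) (proj₂ (divide x 2)) , upper (proj₁ (divide x 2)) (proj₂ (divide x 2)) , ⊔-spec (x /ℕ 2) (+ 0)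
  where
    lower : ∀ (r : Fin 2) → x ≡ + toℕ r ℤ.+ multiple 2 (x /ℕ 2) → multiple 2 (x /ℕ 2) ℤ.≤ x
    lower zero = lia (var 0 ≗ # 0 ⊕ 2 ⊛ var 1 implies 2 ⊛ var 1 ≼ var 0) refl (x ∷ x /ℕ 2 ∷ [])
    lower (suc zero) = lia (var 0 ≗ # 1 ⊕ 2 ⊛ var 1 implies 2 ⊛ var 1 ≼ var 0) refl (x ∷ x /ℕ 2 ∷ [])
    upper : ∀ (r : Fin 2) → x ≡ + toℕ r ℤ.+ multiple 2 (x /ℕ 2) → x ℤ.≤ + 1 ℤ.+ multiple 2 (x /ℕ 2)
    upper zero = lia (var 0 ≗ # 0 ⊕ 2 ⊛ var 1 implies var 0 ≼ # 1 ⊕ 2 ⊛ var 1) refl (x ∷ x /ℕ 2 ∷ [])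
    upper (suc zero) = lia (var 0 ≗ # 1 ⊕ 2 ⊛ var 1 implies var 0 ≼ # 1 ⊕ 2 ⊛ var 1) refl (x ∷ x /ℕ 2 ∷ [])

floorHalf⁺-mono : ∀ {x y} → x ℤ.≤ y → floorHalf⁺ x ℤ.≤ floorHalf⁺ y
floorHalf⁺-mono {x} {y} = lia
  (halfSpec (var 0) (var 1) (var 2) implies halfSpec (var 3) (var 4) (var 5) implies var 0 ≼ var 3 implies var 2 ≼ var 5)
  refl (x ∷ x /ℕ 2 ∷ floorHalf⁺ x ∷ y ∷ y /ℕ 2 ∷ floorHalf⁺ y ∷ []) (half x) (half y)

-- dinv on the regions

sc-spec : ∀ n p → ⟦ scSpec (var 1) (var 2) ⟧ (+ n ∷ p ∷ + sc n p ∷ [])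
sc-spec n (+ zero) = inj₂ (inj₁ (ℤ.neg-≤-pos {n} {0} , ℤ.≤-refl , sym (ℤ.+-identityʳ (+ n))))
sc-spec n (+ suc p) with suc p ℕ.≤? n
... | yes h = inj₁ (+≤+ (s≤s z≤n) , +≤+ h , difference)
  where
    difference : + (n ℕ.∸ p) ≡ + n ℤ.+ + 1 ℤ.- + suc p
    difference = lia (var 0 ≗ var 1 ⊖ var 2 implies var 0 ≗ var 1 ⊕ # 1 ⊖ (# 1 ⊕ var 2)) refl (+ (n ℕ.∸ p) ∷ + n ∷ + p ∷ [])
      (trans (sym (ℤ.⊖-≥ (ℕ.≤-trans (ℕ.n≤1+n p) h))) (sym (ℤ.m-n≡m⊖n n p)))
... | no h = inj₂ (inj₂ (inj₁ (+≤+ (ℕ.≰⇒> h) , refl)))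
sc-spec n -[1+ p ] with suc p ℕ.≤? n
... | yes h = inj₂ (inj₁ (ℤ.neg-mono-≤ (+≤+ h) , ℤ.-≤+ , sym (ℤ.⊖-≥ h)))
... | no h = inj₂ (inj₂ (inj₂ (below (+≤+ (ℕ.≰⇒> h)) , refl)))
  where
    below : + suc n ℤ.≤ + suc p → + 1 ℤ.+ ℤ.- + suc p ℤ.≤ ℤ.- + n
    below = lia (# 1 ⊕ var 0 ≼ var 1 implies # 1 ⊕ (⊝ var 1) ≼ ⊝ var 0) refl (+ n ∷ + suc p ∷ [])

env : ℤ → ℤ → ℤ → ℤ → ℤ → ℤ → List ℤ → List ℤ
env m E ε j k μ σ = m ∷ E ∷ ε ∷ j ∷ k ∷ μ ∷ σ

-- The formulas of a region only see the six parameters and the three coordinates, wherever these are stored.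
relocate : ∀ r {m E ε j k μ} σ x y z →
  let ρ = env m E ε j k μ (σ ‼ x ∷ σ ‼ y ∷ σ ‼ z ∷ [])
      ρ′ = env m E ε j k μ σ
      a′ = var (6 ℕ.+ x) ; b′ = var (6 ℕ.+ y) ; c′ = var (6 ℕ.+ z) in
  ⟦ cond Symbolic.a Symbolic.b Symbolic.c r ⟧ ρ ≡ ⟦ cond a′ b′ c′ r ⟧ ρ′ ×
  ⟦ member Symbolic.a Symbolic.b Symbolic.c r ⟧ ρ ≡ ⟦ member a′ b′ c′ r ⟧ ρ′ ×
  ⟦ dinvᵉ Symbolic.a Symbolic.b Symbolic.c r ⟧ᵉ ρ ≡ ⟦ dinvᵉ a′ b′ c′ r ⟧ᵉ ρ′ ×
  ⟦ index Symbolic.a Symbolic.b Symbolic.c r ⟧ᵉ ρ ≡ ⟦ index a′ b′ c′ r ⟧ᵉ ρ′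
relocate A₁ _ _ _ _ = refl , refl , refl , refl
relocate A₂ _ _ _ _ = refl , refl , refl , refl
relocate A₃ _ _ _ _ = refl , refl , refl , refl
relocate B₁ _ _ _ _ = refl , refl , refl , refl
relocate B₂ _ _ _ _ = refl , refl , refl , refl
relocate B₃ _ _ _ _ = refl , refl , refl , refl
relocate C₁ _ _ _ _ = refl , refl , refl , refl
relocate C₂ _ _ _ _ = refl , refl , refl , refl
relocate C₃ _ _ _ _ = refl , refl , refl , refl
relocate D₀₀₀ _ _ _ _ = refl , refl , refl , refl
relocate D₀₁₁ _ _ _ _ = refl , refl , refl , refl
relocate D₁₁₀ _ _ _ _ = refl , refl , refl , refl
relocate D₀₀₁ _ _ _ _ = refl , refl , refl , refl
relocate D₁₀₀ _ _ _ _ = refl , refl , refl , refl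
relocate D₁₁₁ _ _ _ _ = refl , refl , refl , refl

coe : ∀ {A B : Set} → A ≡ B → A → B
coe = subst id

-- Words of a fibre and their indices

module Fibre (m j k : ℕ) (E ε μ : ℤ) where

  -- `E`, `ε`, `μ` stay free until `base` and `isMax` are assumed, so that the membership facts also
  -- serve j + k ≤ 4m, where they are set to 0.
  ρ⟨_,_,_⟩ : ℤ → ℤ → ℤ → List ℤ
  ρ⟨ a , b , c ⟩ = env (+ m) E ε (+ j) (+ k) μ (a ∷ b ∷ c ∷ [])

  Member : Region → ℤ → ℤ → ℤ → Set
  Member r a b c = ⟦ member Symbolic.a Symbolic.b Symbolic.c r ⟧ ρ⟨ a , b , c ⟩

  Index : Region → ℤ → ℤ → ℤ → ℤ
  Index r a b c = ⟦ index Symbolic.a Symbolic.b Symbolic.c r ⟧ᵉ ρ⟨ a , b , c ⟩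

  dinv-on : ∀ r {a b c} → ⟦ cond Symbolic.a Symbolic.b Symbolic.c r ⟧ ρ⟨ + a , + b , + c ⟩ →
    + dinv m (word 0 a b c) ≡ ⟦ dinvᵉ Symbolic.a Symbolic.b Symbolic.c r ⟧ᵉ ρ⟨ + a , + b , + c ⟩
  dinv-on r {a} {b} {c} h =
    let cond≡ , _ , dinv≡ , _ = relocate r σ 0 1 2
    in trans
      (dinvᵉ-correct r (env (+ m) E ε (+ j) (+ k) μ σ) (coe cond≡ h)
        (sc-spec m (+ 0 ℤ.- + a)) (sc-spec m (+ 0 ℤ.- + b)) (sc-spec m (+ 0 ℤ.- + c))
        (sc-spec m (+ a ℤ.- + b)) (sc-spec m (+ a ℤ.- + c)) (sc-spec m (+ b ℤ.- + c)))
      (sym dinv≡)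
    where
      σ : List ℤ
      σ = + a ∷ + b ∷ + c ∷ + sc m (+ 0 ℤ.- + a) ∷ + sc m (+ 0 ℤ.- + b) ∷ + sc m (+ 0 ℤ.- + c) ∷
          + sc m (+ a ℤ.- + b) ∷ + sc m (+ a ℤ.- + c) ∷ + sc m (+ b ℤ.- + c) ∷ []

  InFibre : Word4 → Set
  InFibre w = ∃[ r ] ∃[ a ] ∃[ b ] ∃[ c ] (w ≡ word 0 a b c × Member r (+ a) (+ b) (+ c))

  ∈-fibre⁻ : ∀ {w} → w ∈ fibre m j k → InFibre w
  ∈-fibre⁻ p with ∈-filter⁻ (hasDegrees? m j k) {xs = W4 m} p
  ... | w∈ , area≡ , dinv≡ with ∈-W4⁻ m w∈
  ...   | a , b , c , refl , a≤ , b≤ , c≤ with cond-exhaustive ρ⟨ + a , + b , + c ⟩ (+≤+ z≤n , +≤+ a≤ , +≤+ z≤n , +≤+ b≤ , +≤+ z≤n , +≤+ c≤)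
  ...     | r , h = r , a , b , c , refl , h , cong +_ (sym area≡) , trans (cong +_ (sym dinv≡)) (dinv-on r h)

  ∈-fibre⁺ : ∀ r {a b c} → Member r a b c →
    ∃[ a′ ] ∃[ b′ ] ∃[ c′ ] (word 0 a′ b′ c′ ∈ fibre m j k × Member r (+ a′) (+ b′) (+ c′) × a ≡ + a′ × b ≡ + b′ × c ≡ + c′)
  ∈-fibre⁺ r {a} {b} {c} (h , area≡ , dinv≡) with cond⇒isWord r ρ⟨ a , b , c ⟩ h
  ... | +≤+ {n = a′} _ , +≤+ a≤ , +≤+ {n = b′} _ , +≤+ b≤ , +≤+ {n = c′} _ , +≤+ c≤ =
    a′ , b′ , c′ ,
    ∈-filter⁺ (hasDegrees? m j k) (∈-W4⁺ m a≤ b≤ c≤)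
      (ℤ.+-injective (sym area≡) , ℤ.+-injective (trans (dinv-on r h) (sym dinv≡))) ,
    (h , area≡ , dinv≡) , refl , refl , refl

  module _ (base-holds : ⟦ base ⟧ (+ m ∷ E ∷ ε ∷ + j ∷ + k ∷ [])) (max-holds : ⟦ isMax ⟧ (+ m ∷ E ∷ ε ∷ + j ∷ + k ∷ μ ∷ [])) where

    Window : ℤ → Set
    Window i = ⟦ window (var 6) ⟧ (env (+ m) E ε (+ j) (+ k) μ (i ∷ []))

    Indexed : Word4 → ℤ → Set
    Indexed w i = ∃[ r ] ∃[ a ] ∃[ b ] ∃[ c ] (w ≡ word 0 a b c × Member r (+ a) (+ b) (+ c) × i ≡ Index r (+ a) (+ b) (+ c))

    indexed-total : ∀ {w} → w ∈ fibre m j k → ∃[ i ] (Window i × Indexed w i)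
    indexed-total p =
      let r , a , b , c , eq , h = ∈-fibre⁻ p
      in Index r (+ a) (+ b) (+ c) , index-window r ρ⟨ + a , + b , + c ⟩ base-holds max-holds h , r , a , b , c , eq , h , refl

    indexed-functional : ∀ {w i i′} → Indexed w i → Indexed w i′ → i ≡ i′
    indexed-functional (r , a , b , c , refl , h , refl) (s , _ , _ , _ , refl , h′ , refl) =
      index-functional r s ρ⟨ + a , + b , + c ⟩ (proj₁ h) (proj₁ h′)

    private
      coordinates : ∀ {a b c a′ b′ c′} → + a ≡ + a′ × + b ≡ + b′ × + c ≡ + c′ → word 0 a b c ≡ word 0 a′ b′ c′
      coordinates (refl , refl , refl) = refl

    indexed-injective : ∀ {w w′ i} → Indexed w i → Indexed w′ i → w ≡ w′
    indexed-injective (r , a , b , c , refl , h , i≡) (s , a′ , b′ , c′ , refl , h′ , i≡′) =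
      let σ = + a ∷ + b ∷ + c ∷ + a′ ∷ + b′ ∷ + c′ ∷ []
          _ , member≡ , _ , index≡ = relocate r {+ m} {E} {ε} {+ j} {+ k} {μ} σ 0 1 2
          _ , member≡′ , _ , index≡′ = relocate s {+ m} {E} {ε} {+ j} {+ k} {μ} σ 3 4 5
      in coordinates (index-injective r s (env (+ m) E ε (+ j) (+ k) μ σ) base-holds max-holds
           (coe member≡ h) (coe member≡′ h′) (trans (sym index≡) (trans (sym i≡) (trans i≡′ index≡′))))

    Locus : Region → ℤ → ℤ → ℤ → ℤ → ℤ → Set
    Locus r i y a b c = ⟦ locus r ⟧ (env (+ m) E ε (+ j) (+ k) μ (a ∷ b ∷ c ∷ i ∷ y ∷ []))

    private
      indexed : ∀ {i} r {a b c} → Member r a b c → i ≡ Index r a b c → ∃[ w ] (w ∈ fibre m j k × Indexed w i)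
      indexed r h i≡ with ∈-fibre⁺ r h
      ... | a′ , b′ , c′ , w∈ , h′ , refl , refl , refl = word 0 a′ b′ c′ , w∈ , r , a′ , b′ , c′ , refl , h′ , i≡

    attained : ∀ {i} → Window i → ∀ r y a b c → Locus r i y a b c → ∃[ w ] (w ∈ fibre m j k × Indexed w i)
    attained {i} win r y a b c l =
      let σ = a ∷ b ∷ c ∷ i ∷ y ∷ []
          _ , member≡ , _ , index≡ = relocate r {+ m} {E} {ε} {+ j} {+ k} {μ} σ 0 1 2
          h , i≡ = locus-sound r (env (+ m) E ε (+ j) (+ k) μ σ) base-holds max-holds (+≤+ z≤n) (+≤+ z≤n) win l
      in indexed r (coe (sym member≡) h) (trans i≡ (sym index≡))

    ε-cases : ε ≡ + 0 ⊎ ε ≡ + 1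
    ε-cases = lia (base implies Symbolic.ε ≗ # 0 or Symbolic.ε ≗ # 1) refl (+ m ∷ E ∷ ε ∷ + j ∷ + k ∷ []) base-holds

    indexed-onto : ∀ {i} → Window i → ∃[ w ] (w ∈ fibre m j k × Indexed w i)
    -- The index is read from slot 9; the three coordinate slots before it hold placeholders.
    indexed-onto {i} win = located (window-covered (env (+ m) E ε (+ j) (+ k) μ (i ∷ i ∷ i ∷ i ∷ [])) base-holds max-holds (+≤+ z≤n) (+≤+ z≤n) win)
      where
        σ : List ℤ
        σ = env (+ m) E ε (+ j) (+ k) μ (i ∷ i ∷ i ∷ i ∷ [])
        quotient : (x : Expr) (n : ℕ) .{{_ : NonZero n}} → ∃[ r ] ∃[ y ] (⟦ x ⟧ᵉ σ ≡ + toℕ {n} r ℤ.+ multiple n y)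
        quotient x n = proj₁ (divide (⟦ x ⟧ᵉ σ) n) , _ , proj₂ (divide (⟦ x ⟧ᵉ σ) n)
        found : ∀ r {y a b c} → Locus r i y a b c → ∃[ w ] (w ∈ fibre m j k × Indexed w i)
        found r = attained win r _ _ _ _
        located : ⟦ inD or inA₁ or inA₂₃ or inB₁₂C₂₃ or inB₃C₁ ⟧ σ → ∃[ w ] (w ∈ fibre m j k × Indexed w i)
        -- In the D regions e has the parity of the number of inversions of (a,b,c), so `ε` leaves
        -- three regions, and the residue modulo 3 selects one.
        located (inj₁ p) with ε-cases | quotient (Symbolic.i ⊕ Symbolic.j ⊖ 2 ⊛ Symbolic.E ⊖ Symbolic.ε) 3
        ... | inj₁ ε≡ | zero , y , eq = found D₀₀₀ {y} (p , ε≡ , eq , refl , refl , refl)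
        ... | inj₁ ε≡ | suc zero , y , eq = found D₁₁₀ {y} (p , ε≡ , eq , refl , refl , refl)
        ... | inj₁ ε≡ | suc (suc zero) , y , eq = found D₀₁₁ {y} (p , ε≡ , eq , refl , refl , refl)
        ... | inj₂ ε≡ | zero , y , eq = found D₀₀₁ {y} (p , ε≡ , eq , refl , refl , refl)
        ... | inj₂ ε≡ | suc zero , y , eq = found D₁₀₀ {y} (p , ε≡ , eq , refl , refl , refl)
        ... | inj₂ ε≡ | suc (suc zero) , y , eq = found D₁₁₁ {y} (p , ε≡ , eq , refl , refl , refl)
        located (inj₂ (inj₁ p)) = found A₁ {i} (p , refl , refl , refl)
        located (inj₂ (inj₂ (inj₁ p))) with quotient (5 ⊛ Symbolic.m ⊕ Symbolic.i ⊖ Symbolic.E ⊖ Symbolic.k) 2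
        ... | zero , y , eq = found A₂ {y} (p , eq , refl , refl , refl)
        ... | suc zero , y , eq = found A₃ {y} (p , eq , refl , refl , refl)
        located (inj₂ (inj₂ (inj₂ (inj₁ p)))) with quotient κ 4
        ... | zero , y , eq = found C₂ {y} (p , eq , refl , refl , refl)
        ... | suc zero , y , eq = found B₁ {y} (p , eq , refl , refl , refl)
        ... | suc (suc zero) , y , eq = found C₃ {y} (p , eq , refl , refl , refl)
        ... | suc (suc (suc zero)) , y , eq = found B₂ {y} (p , eq , refl , refl , refl)
        located (inj₂ (inj₂ (inj₂ (inj₂ p)))) with quotient τ 2
        ... | zero , y , eq = found C₁ {y} (p , eq , refl , refl , refl)
        ... | suc zero , y , eq = found B₃ {y} (p , eq , refl , refl , refl)

open import Data.Nat using (_+_; _*_; _∸_; _<_; _>_; _≤_; ⌊_/2⌋; ⌈_/2⌉)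

-- Coefficients of degree above 4m

length-interval : ∀ {A : Set} (I : A → ℤ → Set) lo N {xs} → Unique xs →
  (∀ {x} → x ∈ xs → ∃[ i ] ((lo ℤ.≤ i × + 1 ℤ.+ i ℤ.≤ lo ℤ.+ + N) × I x i)) →
  (∀ {i} → lo ℤ.≤ i × + 1 ℤ.+ i ℤ.≤ lo ℤ.+ + N → ∃[ x ] (x ∈ xs × I x i)) →
  (∀ {x x′ i} → x ∈ xs → x′ ∈ xs → I x i → I x′ i → x ≡ x′) →
  (∀ {x i i′} → I x i → I x i′ → i ≡ i′) → length xs ≡ N
length-interval I lo N u total onto injective functional = length-≡ (λ x t → I x (lo ℤ.+ + t)) u
  (λ {x} p → let i , bounds , h = total p ; t , t<N , eq = offset i bounds in t , t<N , subst (I x) eq h)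
  (λ {t} t<N → onto (interior t (+≤+ t<N) (+≤+ z≤n)))
  injective
  (λ h h′ → ℤ.+-injective (cancel (functional h h′)))
  where
    offset : ∀ i → lo ℤ.≤ i × + 1 ℤ.+ i ℤ.≤ lo ℤ.+ + N → ∃[ t ] (t ℕ.< N × i ≡ lo ℤ.+ + t)
    offset i (lo≤i , i<hi) = go (i ℤ.- lo)
      (lia (var 0 ≼ var 1 implies # 0 ≼ var 1 ⊖ var 0) refl (lo ∷ i ∷ []) lo≤i)
      (lia (# 1 ⊕ var 1 ≼ var 0 ⊕ var 2 implies # 1 ⊕ (var 1 ⊖ var 0) ≼ var 2) refl (lo ∷ i ∷ + N ∷ []) i<hi)
      (lia (var 1 ≗ var 0 ⊕ (var 1 ⊖ var 0)) refl (lo ∷ i ∷ []))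
      where
        go : ∀ t → + 0 ℤ.≤ t → + 1 ℤ.+ t ℤ.≤ + N → i ≡ lo ℤ.+ t → ∃[ t ] (t ℕ.< N × i ≡ lo ℤ.+ + t)
        go (+ t) _ (+≤+ t<N) eq = t , t<N , eq
    interior : ∀ t → + 1 ℤ.+ + t ℤ.≤ + N → + 0 ℤ.≤ + t → lo ℤ.≤ lo ℤ.+ + t × + 1 ℤ.+ (lo ℤ.+ + t) ℤ.≤ lo ℤ.+ + N
    interior t = lia (# 1 ⊕ var 1 ≼ var 2 implies # 0 ≼ var 1 implies
      var 0 ≼ var 0 ⊕ var 1 and # 1 ⊕ (var 0 ⊕ var 1) ≼ var 0 ⊕ var 2) refl (lo ∷ + t ∷ + N ∷ [])
    cancel : ∀ {t t′} → lo ℤ.+ + t ≡ lo ℤ.+ + t′ → + t ≡ + t′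
    cancel {t} {t′} = lia (var 0 ⊕ var 1 ≗ var 0 ⊕ var 2 implies var 1 ≗ var 2) refl (lo ∷ + t ∷ + t′ ∷ [])

minSpec : Expr → Expr → Expr → Formula
minSpec x y u = (u ≗ x and x ≼ y) or (u ≗ y and y ≼ x)

-- In the window, lo = max(e - j, 0); the number of indices is the minimum of the three floors.
module _ where
  private
    lo N x₁ q₁ v₁ x₂ q₂ v₂ x₃ q₃ v₃ u : Expr
    lo = var 7
    N = var 8
    q₁ = var 9
    v₁ = var 10
    q₂ = var 11
    v₂ = var 12
    q₃ = var 13
    v₃ = var 14
    u = var 15
    x₁ = (⊝ (6 ⊛ Symbolic.m)) ⊕ # 2 ⊕ 3 ⊛ Symbolic.j ⊕ Symbolic.k
    x₂ = 6 ⊛ Symbolic.m ⊕ # 2 ⊖ Symbolic.j ⊖ Symbolic.k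
    x₃ = (⊝ (6 ⊛ Symbolic.m)) ⊕ # 2 ⊕ Symbolic.j ⊕ 3 ⊛ Symbolic.k

  window-intervalᶠ : Formula
  window-intervalᶠ = base implies halfSpec x₁ q₁ v₁ implies halfSpec x₂ q₂ v₂ implies halfSpec x₃ q₃ v₃ implies
    minSpec v₁ v₂ u implies minSpec u v₃ N implies
    ((lo ≗ Symbolic.e ⊖ Symbolic.j and # 0 ≼ Symbolic.e ⊖ Symbolic.j) or (lo ≗ # 0 and Symbolic.e ⊖ Symbolic.j ≼ # 0)) implies
    # 0 ≼ N and (window (var 6) implies lo ≼ var 6 and # 1 ⊕ var 6 ≼ lo ⊕ N) and
    (lo ≼ var 6 and # 1 ⊕ var 6 ≼ lo ⊕ N implies window (var 6))

  window-interval : ∀ ρ → ⟦ window-intervalᶠ ⟧ ρ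
  window-interval = lia window-intervalᶠ refl

module _ (m j k : ℕ) where
  private
    defect : ℤ
    defect = + (6 ℕ.* m) ℤ.- + j ℤ.- + k

    x₁ x₂ x₃ E ε μ lo N : ℤ
    x₁ = ℤ.- + (6 ℕ.* m) ℤ.+ + 2 ℤ.+ + (3 ℕ.* j) ℤ.+ + k
    x₂ = + (6 ℕ.* m) ℤ.+ + 2 ℤ.- + j ℤ.- + k
    x₃ = ℤ.- + (6 ℕ.* m) ℤ.+ + 2 ℤ.+ + j ℤ.+ + (3 ℕ.* k)
    E = defect /ℕ 2
    ε = + toℕ (proj₁ (divide defect 2))
    μ = + k ⊔ (multiple 2 E ℤ.+ ε)
    lo = (multiple 2 E ℤ.+ ε ℤ.- + j) ⊔ + 0
    N = floorHalf⁺ x₁ ⊓ floorHalf⁺ x₂ ⊓ floorHalf⁺ x₃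

    remainder : ∀ (r : Fin 2) → + 0 ℤ.≤ + toℕ r × + toℕ r ℤ.≤ + 1
    remainder zero = +≤+ z≤n , +≤+ z≤n
    remainder (suc zero) = +≤+ z≤n , +≤+ (s≤s z≤n)

  coeff-above : j ℕ.+ k ℕ.> 4 ℕ.* m → + coeff m j k ≡ N
  coeff-above 4m<d = trans (cong +_ (length-interval Indexed′ lo ∣ N ∣ (fibre-unique m j k)
      (λ p → let i , win , h = indexed-total base-holds max-holds p in i , subst (Bounds i) (sym +N) (proj₁ (proj₂ (bounds i)) win) , h)
      (λ {i} b → indexed-onto base-holds max-holds (proj₂ (proj₂ (bounds i)) (subst (Bounds i) +N b)))
      (λ _ _ → indexed-injective base-holds max-holds)
      (indexed-functional base-holds max-holds)))
    +N
    where
      open Fibre m j k E ε μ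

      base-holds : ⟦ base ⟧ (+ m ∷ E ∷ ε ∷ + j ∷ + k ∷ [])
      base-holds = lia
        (6 ⊛ Symbolic.m ⊖ Symbolic.j ⊖ Symbolic.k ≗ Symbolic.ε ⊕ 2 ⊛ Symbolic.E implies # 0 ≼ Symbolic.ε and Symbolic.ε ≼ # 1 implies
         # 1 ⊕ 4 ⊛ Symbolic.m ≼ Symbolic.j ⊕ Symbolic.k implies base)
        refl (+ m ∷ E ∷ ε ∷ + j ∷ + k ∷ []) (proj₂ (divide defect 2)) (remainder (proj₁ (divide defect 2))) (+≤+ 4m<d)

      max-holds : ⟦ isMax ⟧ (+ m ∷ E ∷ ε ∷ + j ∷ + k ∷ μ ∷ [])
      max-holds = ⊔-spec (+ k) (multiple 2 E ℤ.+ ε)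

      Indexed′ : Word4 → ℤ → Set
      Indexed′ = Indexed base-holds max-holds

      Bounds : ℤ → ℤ → Set
      Bounds i n = lo ℤ.≤ i × + 1 ℤ.+ i ℤ.≤ lo ℤ.+ n

      bounds : ∀ i → + 0 ℤ.≤ N × (Window base-holds max-holds i → Bounds i N) × (Bounds i N → Window base-holds max-holds i)
      bounds i = window-interval
        (+ m ∷ E ∷ ε ∷ + j ∷ + k ∷ μ ∷ i ∷ lo ∷ N ∷ x₁ /ℕ 2 ∷ floorHalf⁺ x₁ ∷ x₂ /ℕ 2 ∷ floorHalf⁺ x₂ ∷
         x₃ /ℕ 2 ∷ floorHalf⁺ x₃ ∷ floorHalf⁺ x₁ ⊓ floorHalf⁺ x₂ ∷ [])
        base-holds (half x₁) (half x₂) (half x₃) (⊓-spec _ _) (⊓-spec _ _) (⊔-spec _ _)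

      +N : + ∣ N ∣ ≡ N
      +N = ℤ.0≤i⇒+∣i∣≡i (proj₁ (bounds (+ 0)))

-- For j + k = 4m the words are (0,b,c) with b ≤ m ≤ c ≤ b + m, so b runs from ⌈(j - m)/2⌉ to min(m, j - m).
module _ (m j k : ℕ) where
  private
    y₁ y₂ start N : ℤ
    y₁ = ℤ.- + m ℤ.+ + 2 ℤ.+ + j
    y₂ = ℤ.- + m ℤ.+ + 2 ℤ.+ + k
    -- This may be negative when j < m, but then `floorHalf⁺ y₁` is 0 and the interval is empty.
    start = (+ j ℤ.- + m ℤ.+ + 1) /ℕ 2
    N = floorHalf⁺ y₁ ⊓ floorHalf⁺ y₂

    open Fibre m j k (+ 0) (+ 0) (+ 0)

    Second : Word4 → ℤ → Set
    Second w b = ∃[ b′ ] ∃[ c ] (w ≡ word 0 0 b′ c × j ≡ b′ ℕ.+ c × b ≡ + b′)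

    Edge : ℤ → Set
    Edge b = + 0 ℤ.≤ b × b ℤ.≤ + m × b ℤ.+ + m ℤ.≤ + j × + j ℤ.- b ℤ.≤ b ℤ.+ + m

    -- Slots 1 and 2, which hold `E` and `ε` elsewhere, here carry `start` and the index.
    boundsᶠ : Formula
    boundsᶠ = Symbolic.j ⊕ Symbolic.k ≗ 4 ⊛ Symbolic.m implies
      halfSpec ((⊝ Symbolic.m) ⊕ # 2 ⊕ Symbolic.j) (var 5) (var 6) implies halfSpec ((⊝ Symbolic.m) ⊕ # 2 ⊕ Symbolic.k) (var 7) (var 8) implies
      halfSpec (Symbolic.j ⊖ Symbolic.m ⊕ # 1) (var 1) (var 10) implies minSpec (var 6) (var 8) (var 9) implies
      # 0 ≼ var 9 and
      (# 0 ≼ var 2 and var 2 ≼ Symbolic.m and var 2 ⊕ Symbolic.m ≼ Symbolic.j and Symbolic.j ⊖ var 2 ≼ var 2 ⊕ Symbolic.m implies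
        var 1 ≼ var 2 and # 1 ⊕ var 2 ≼ var 1 ⊕ var 9) and
      (var 1 ≼ var 2 and # 1 ⊕ var 2 ≼ var 1 ⊕ var 9 implies
        # 0 ≼ var 2 and var 2 ≼ Symbolic.m and var 2 ⊕ Symbolic.m ≼ Symbolic.j and Symbolic.j ⊖ var 2 ≼ var 2 ⊕ Symbolic.m)

  -- From ⌈(j - m)/2⌉ the distances to j - m and to m are ⌊(j - m)/2⌋ and ⌊(3m - j)/2⌋ = ⌊(k -
  -- m)/2⌋; adding 1 gives the two floors.
  coeff-on : j ℕ.+ k ≡ 4 ℕ.* m → + coeff m j k ≡ N
  coeff-on d≡4m = trans (cong +_ (length-interval Second start ∣ N ∣ (fibre-unique m j k) total onto
      (λ _ _ → injective) functional)) +N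
    where
      bounds : ∀ i → + 0 ℤ.≤ N × (Edge i → start ℤ.≤ i × + 1 ℤ.+ i ℤ.≤ start ℤ.+ N) ×
        (start ℤ.≤ i × + 1 ℤ.+ i ℤ.≤ start ℤ.+ N → Edge i)
      bounds i = lia boundsᶠ refl
        (+ m ∷ start ∷ i ∷ + j ∷ + k ∷ y₁ /ℕ 2 ∷ floorHalf⁺ y₁ ∷ y₂ /ℕ 2 ∷ floorHalf⁺ y₂ ∷ N ∷ floorHalf⁺ (+ j ℤ.- + m ℤ.+ + 1) ∷ [])
        (cong +_ d≡4m) (half y₁) (half y₂) (half (+ j ℤ.- + m ℤ.+ + 1)) (⊓-spec _ _)

      +N : + ∣ N ∣ ≡ N
      +N = ℤ.0≤i⇒+∣i∣≡i (proj₁ (bounds (+ 0)))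

      Bounds : ℤ → ℤ → Set
      Bounds i n = start ℤ.≤ i × + 1 ℤ.+ i ℤ.≤ start ℤ.+ n

      total : ∀ {w} → w ∈ fibre m j k → ∃[ i ] (Bounds i (+ ∣ N ∣) × Second w i)
      total p = let r , a , b , c , w≡ , h = ∈-fibre⁻ p in
        edge a b c w≡ (proj₁ (proj₂ h)) (cond⇒isWord r ρ⟨ + a , + b , + c ⟩ (proj₁ h)) (degree≡4m r ρ⟨ + a , + b , + c ⟩ h (cong +_ d≡4m))
        where
          edge : ∀ a b c {w} → w ≡ word 0 a b c → + j ≡ + a ℤ.+ + b ℤ.+ + c → ⟦ isWord ⟧ ρ⟨ + a , + b , + c ⟩ →
            + a ≡ + 0 × + b ℤ.≤ + m × + m ℤ.≤ + c → ∃[ i ] (Bounds i (+ ∣ N ∣) × Second w i)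
          edge _ b c w≡ j≡ (_ , _ , 0≤b , _ , _ , c≤) (refl , b≤ , ≤c) =
            + b , subst (Bounds (+ b)) (sym +N) (proj₁ (proj₂ (bounds (+ b)))
              (0≤b , b≤ ,
               lia (var 0 ≗ # 0 ⊕ var 2 ⊕ var 3 implies var 1 ≼ var 3 implies var 2 ⊕ var 1 ≼ var 0) refl (+ j ∷ + m ∷ + b ∷ + c ∷ []) j≡ ≤c ,
               lia (var 0 ≗ # 0 ⊕ var 2 ⊕ var 3 implies var 3 ≼ var 2 ⊕ var 1 implies var 0 ⊖ var 2 ≼ var 2 ⊕ var 1) refl (+ j ∷ + m ∷ + b ∷ + c ∷ []) j≡ c≤)) ,
            b , c , w≡ , ℤ.+-injective j≡ , refl

      placed : ∀ {b c} → + b ℤ.≤ + m → + m ℤ.≤ c → c ℤ.≤ + b ℤ.+ + m → + j ≡ + b ℤ.+ c → ∃[ w ] (w ∈ fibre m j k × Second w (+ b))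
      placed {b} {+ c} b≤m m≤c c≤ j≡ =
        let r , h = cond-exhaustive ρ⟨ + 0 , + b , + c ⟩ (+≤+ z≤n , +≤+ z≤n , +≤+ z≤n , b≤m , +≤+ z≤n , c≤)
            k≡ = lia (var 0 ⊕ var 1 ≗ 4 ⊛ var 2 implies var 0 ≗ var 3 ⊕ var 4 implies var 3 ⊕ var 4 ⊕ var 5 ≗ 4 ⊛ var 2 implies var 1 ≗ var 5)
                   refl (+ j ∷ + k ∷ + m ∷ + b ∷ + c ∷ ⟦ dinvᵉ Symbolic.a Symbolic.b Symbolic.c r ⟧ᵉ ρ⟨ + 0 , + b , + c ⟩ ∷ [])
                   (cong +_ d≡4m) j≡ (degree≡4m⁻¹ r ρ⟨ + 0 , + b , + c ⟩ h (refl , b≤m , m≤c))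
        in same (∈-fibre⁺ r {+ 0} {+ b} {+ c} (h , j≡ , k≡))
        where
          same : ∃[ a′ ] ∃[ b′ ] ∃[ c′ ] (word 0 a′ b′ c′ ∈ fibre m j k × _ × + 0 ≡ + a′ × + b ≡ + b′ × + c ≡ + c′) →
            ∃[ w ] (w ∈ fibre m j k × Second w (+ b))
          same (_ , _ , _ , w∈ , _ , refl , refl , refl) = _ , w∈ , b , c , refl , ℤ.+-injective j≡ , refl

      onto : ∀ {i} → Bounds i (+ ∣ N ∣) → ∃[ w ] (w ∈ fibre m j k × Second w i)
      onto {i} h = go i (proj₂ (proj₂ (bounds i)) (subst (Bounds i) +N h))
        where
          go : ∀ i → Edge i → ∃[ w ] (w ∈ fibre m j k × Second w i)
          go (+ b) (_ , b≤m , m≤c , c≤) = placed {b} {+ j ℤ.- + b} b≤m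
            (lia (var 2 ⊕ var 1 ≼ var 0 implies var 1 ≼ var 0 ⊖ var 2) refl (+ j ∷ + m ∷ + b ∷ []) m≤c) c≤
            (lia (var 0 ≗ var 2 ⊕ (var 0 ⊖ var 2)) refl (+ j ∷ + m ∷ + b ∷ []))

      injective : ∀ {w w′ i} → Second w i → Second w′ i → w ≡ w′
      injective (b , c , refl , j≡ , refl) (_ , c′ , refl , j≡′ , refl) =
        cong (word 0 0 b) (ℕ.+-cancelˡ-≡ b c c′ (trans (sym j≡) j≡′))

      functional : ∀ {w i i′} → Second w i → Second w i′ → i ≡ i′
      functional (b , c , refl , _ , refl) (_ , _ , refl , _ , refl) = refl

coeff-below : ∀ m j k → j ℕ.+ k ℕ.< 4 ℕ.* m → coeff m j k ≡ 0
coeff-below m j k d<4m = empty (fibre m j k) λ p →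
  let open Fibre m j k (+ 0) (+ 0) (+ 0)
      r , a , b , c , _ , h = ∈-fibre⁻ p
  in ℤ.<⇒≱ (ℤ.+<+ d<4m) (degree≥4m r ρ⟨ + a , + b , + c ⟩ h)
  where
    empty : ∀ {A : Set} (xs : List A) → (∀ {x} → x ∈ xs → ⊥) → length xs ≡ 0
    empty [] _ = refl
    empty (x ∷ xs) ∉ = ⊥-elim (∉ (here refl))

-- Unimodality along an antidiagonal

unimodal-min : ∀ d (s : ℕ → ℕ) (g : ℕ → ℤ) (F : ℤ → ℤ) →
  (∀ {x y} → x ℕ.≤ y → g x ℤ.≤ g y) → (∀ {x y} → x ℤ.≤ y → F x ℤ.≤ F y) →
  (∀ {i} → i ℕ.≤ d → + s i ≡ F (g (d ∸ i) ⊓ g i)) → Unimodal d s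
-- The minimum is g at min(d - i, i), which peaks at i = ⌊d/2⌋.
unimodal-min d s g F g-mono F-mono s≡ = ⌊ d /2⌋ , ℕ.⌊n/2⌋≤n d ,
  (λ i i<p → compare (ℕ.≤-trans (ℕ.<⇒≤ i<p) (ℕ.⌊n/2⌋≤n d)) (ℕ.≤-trans i<p (ℕ.⌊n/2⌋≤n d))
    (ℤ.≤-trans (ℤ.i⊓j≤j (g (d ∸ i)) (g i)) (ℤ.⊓-glb (g-mono (left i<p)) (g-mono (ℕ.n≤1+n i))))) ,
  (λ i p≤i i<d → compare i<d (ℕ.<⇒≤ i<d)
    (ℤ.≤-trans (ℤ.i⊓j≤i (g (d ∸ suc i)) (g (suc i)))
      (ℤ.⊓-glb (g-mono (ℕ.∸-monoʳ-≤ d (ℕ.n≤1+n i))) (g-mono (right p≤i)))))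
  where
    compare : ∀ {i i′} → i ℕ.≤ d → i′ ℕ.≤ d → g (d ∸ i) ⊓ g i ℤ.≤ g (d ∸ i′) ⊓ g i′ → s i ℕ.≤ s i′
    compare i≤d i′≤d h = ℤ.drop‿+≤+ (subst₂ ℤ._≤_ (sym (s≡ i≤d)) (sym (s≡ i′≤d)) (F-mono h))
    left : ∀ {i} → i ℕ.< ⌊ d /2⌋ → i ℕ.≤ d ∸ suc i
    left {i} i<p = ℕ.m+n≤o⇒m≤o∸n i (subst (i + suc i ℕ.≤_) (ℕ.⌊n/2⌋+⌈n/2⌉≡n d)
      (ℕ.+-mono-≤ (ℕ.<⇒≤ i<p) (ℕ.≤-trans i<p (ℕ.⌊n/2⌋≤⌈n/2⌉ d))))
    right : ∀ {i} → ⌊ d /2⌋ ℕ.≤ i → d ∸ suc i ℕ.≤ i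
    right {i} p≤i = ℕ.m≤n+o⇒m∸n≤o d (suc i) (subst (ℕ._≤ suc i + i) (ℕ.⌊n/2⌋+⌈n/2⌉≡n d)
      (ℕ.≤-trans (ℕ.+-mono-≤ p≤i (ℕ.≤-trans (⌈n/2⌉≤1+⌊n/2⌋ d) (s≤s p≤i))) (ℕ.≤-reflexive (ℕ.+-suc i i))))
      where
        ⌈n/2⌉≤1+⌊n/2⌋ : ∀ n → ⌈ n /2⌉ ℕ.≤ suc ⌊ n /2⌋
        ⌈n/2⌉≤1+⌊n/2⌋ zero = z≤n
        ⌈n/2⌉≤1+⌊n/2⌋ (suc zero) = s≤s z≤n
        ⌈n/2⌉≤1+⌊n/2⌋ (suc (suc n)) = s≤s (⌈n/2⌉≤1+⌊n/2⌋ n)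

coeff-unimodal : ∀ m d → Unimodal d (λ i → coeff m (d ∸ i) i)
coeff-unimodal m d with ℕ.<-cmp d (4 * m)
... | tri< d<4m _ _ = 0 , z≤n , (λ _ ()) , λ i _ i<d → ℕ.≤-trans (ℕ.≤-reflexive (coeff-below m (d ∸ suc i) (suc i) (subst (_< 4 * m) (sym (ℕ.m∸n+n≡m i<d)) d<4m))) z≤n
... | tri≈ _ d≡4m _ = unimodal-min d _ (λ n → floorHalf⁺ (ℤ.- + m ℤ.+ + 2 ℤ.+ + n)) id
      (λ x≤y → floorHalf⁺-mono (ℤ.+-monoʳ-≤ (ℤ.- + m ℤ.+ + 2) (+≤+ x≤y))) id
      (λ {i} i≤d → coeff-on m (d ∸ i) i (trans (ℕ.m∸n+n≡m i≤d) d≡4m))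
-- As 3j + k = d + 2j and j + 3k = d + 2k, the outer floors are one monotone function at j and at k,
-- and the middle one depends on d alone.
... | tri> _ _ 4m<d = unimodal-min d _ g (_⊓ middle)
      (λ x≤y → floorHalf⁺-mono (ℤ.+-monoʳ-≤ (ℤ.- + (6 * m) ℤ.+ + 2 ℤ.+ + d) (+≤+ (ℕ.*-monoʳ-≤ 2 x≤y))))
      (λ x≤y → ℤ.⊓-monoˡ-≤ middle x≤y)
      (λ {i} i≤d → trans (coeff-above m (d ∸ i) i (subst (4 * m <_) (sym (ℕ.m∸n+n≡m i≤d)) 4m<d))
        (rearrange (d ∸ i) i (ℕ.m∸n+n≡m i≤d)))
  where
    g : ℕ → ℤ
    g n = floorHalf⁺ (ℤ.- + (6 * m) ℤ.+ + 2 ℤ.+ + d ℤ.+ + (2 * n))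
    middle : ℤ
    middle = floorHalf⁺ (+ (6 * m) ℤ.+ + 2 ℤ.- + d)
    rearrange : ∀ j k → j + k ≡ d →
      floorHalf⁺ (ℤ.- + (6 * m) ℤ.+ + 2 ℤ.+ + (3 * j) ℤ.+ + k) ⊓ floorHalf⁺ (+ (6 * m) ℤ.+ + 2 ℤ.- + j ℤ.- + k)
        ⊓ floorHalf⁺ (ℤ.- + (6 * m) ℤ.+ + 2 ℤ.+ + j ℤ.+ + (3 * k))
      ≡ (g j ⊓ g k) ⊓ middle
    rearrange j k j+k≡d = trans
      (cong₂ _⊓_ (cong₂ _⊓_ (cong floorHalf⁺ (first (cong +_ j+k≡d))) (cong floorHalf⁺ (second (cong +_ j+k≡d)))) (cong floorHalf⁺ (third (cong +_ j+k≡d))))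
      (trans (ℤ.⊓-assoc (g j) middle (g k)) (trans (cong (g j ⊓_) (ℤ.⊓-comm middle (g k))) (sym (ℤ.⊓-assoc (g j) (g k) middle))))
      where
        M J K D : Expr
        M = var 0
        J = var 1
        K = var 2
        D = var 3
        σ : List ℤ
        σ = + m ∷ + j ∷ + k ∷ + d ∷ []
        first = lia (J ⊕ K ≗ D implies (⊝ (6 ⊛ M)) ⊕ # 2 ⊕ 3 ⊛ J ⊕ K ≗ (⊝ (6 ⊛ M)) ⊕ # 2 ⊕ D ⊕ 2 ⊛ J) refl σ
        second = lia (J ⊕ K ≗ D implies 6 ⊛ M ⊕ # 2 ⊖ J ⊖ K ≗ 6 ⊛ M ⊕ # 2 ⊖ D) refl σ
        third = lia (J ⊕ K ≗ D implies (⊝ (6 ⊛ M)) ⊕ # 2 ⊕ J ⊕ 3 ⊛ K ≗ (⊝ (6 ⊛ M)) ⊕ # 2 ⊕ D ⊕ 2 ⊛ K) refl σ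

theorem4p8 : (m : ℕ) → 1 ≤ m →
    ((j k : ℕ) → j + k > 4 * m →
    + coeff m j k ≡
    floorHalf⁺ (ℤ.- + (6 * m) ℤ.+ + 2 ℤ.+ + (3 * j) ℤ.+ + k)
    ⊓ floorHalf⁺ (+ (6 * m) ℤ.+ + 2 ℤ.- + j ℤ.- + k)
    ⊓ floorHalf⁺ (ℤ.- + (6 * m) ℤ.+ + 2 ℤ.+ + j ℤ.+ + (3 * k)))
    × ((j k : ℕ) → j + k ≡ 4 * m →
    + coeff m j k ≡
    floorHalf⁺ (ℤ.- + m ℤ.+ + 2 ℤ.+ + j)
    ⊓ floorHalf⁺ (ℤ.- + m ℤ.+ + 2 ℤ.+ + k))
    × ((j k : ℕ) → j + k < 4 * m → coeff m j k ≡ 0)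
    × ((d : ℕ) → 1 ≤ d → Unimodal d (λ i → coeff m (d ∸ i) i))
theorem4p8 m _ = coeff-above m , coeff-on m , coeff-below m , λ d _ → coeff-unimodal m d
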